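{- Let $G$ be a simple graph with chromatic number $\chi(G)$ and complement $\overline{G}$. Then $$\lceil \vartheta(\overline{G})\rceil \leq h(G)\leq \chi(G).$$
   Context: Graphs $G=(V,E)$ are finite and simple with $n=|V|\ge 1$ vertices. $\mathbb{S}^V$ is the set of real symmetric matrices with rows and columns indexed by $V$, and $\lambda_1(M)\ge\dots\ge\lambda_n(M)$ are the eigenvalues of $M\in\mathbb{S}^V$ with multiplicity. The condition "$Z_{ij}=0$ for all $ij\notin E$" includes the diagonal positions, so $Z$ has zero diagonal. $h(G)$ is the smallest integer $m\ge1$ such that for all $Z\in\mathbb{S}^V$ with $Z_{ij}=0$ for all $ij\notin E$, $$\lambda_1(Z)+\lambda_n(Z)+\lambda_{n-1}(Z)+\dots+\lambda_{n-m+2}(Z)\le 0,$$ i.e. $\lambda_1(Z)+\sum_{i=1}^{m-1}\lambda_{n+1-i}(Z)\le0$ (for $m=1$ the condition is $\lambda_1(Z)\le0$). The Lovász theta number of a graph $H$ is $$\vartheta(H)=\max\{\langle J,X\rangle : X \text{ real symmetric indexed by } V(H),\ \operatorname{tr}X=1,\ X_{ij}=0\ \forall ij\in E(H),\ X\succcurlyeq0\},$$ where $J$ is the all-ones matrix, $\langle A,B\rangle=\operatorname{tr}(AB)$, and $X\succcurlyeq 0$ means positive semidefinite. -}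

module Defs where

open import Level using (0ℓ)
open import Algebra.Bundles using (CommutativeRing)
open import Algebra.Core using (Op₁; Op₂)
open import Algebra.Structures using (IsCommutativeRing)
import Algebra.Properties.Semiring.Mult as SemiringMult
import Algebra.Properties.Semiring.Sum as SemiringSum
open import Data.Empty using (⊥)
open import Data.Fin.Base as Fin using (Fin; zero; opposite; inject≤)
open import Data.Integer.Base as ℤ using (ℤ; +_; -[1+_])
open import Data.List.Base using (length; filter; allFin)
open import Data.Nat.Base as ℕ using (ℕ; zero; suc)
open import Data.Product.Base using (∃; _×_; _,_; Σ-syntax; ∃-syntax)
open import Data.Vec.Functional using (Vector)
open import Relation.Binary.Core using (Rel)
open import Relation.Binary.Definitions using (Symmetric; Irreflexive; Antitonic₁)
open import Relation.Binary.PropositionalEquality.Core using (_≡_; _≢_; sym)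
open import Relation.Binary.Structures using (IsDecTotalOrder)
open import Relation.Nullary.Negation.Core using (¬_)
open import Relation.Unary using (Pred)

-- The real numbers, axiomatised as a Dedekind-complete ordered field; these
-- axioms determine ℝ up to isomorphism.  Equality is a setoid equality, as
-- for the algebraic bundles of the standard library.
record Reals : Set₁ where
  infix  4 _≈_ _≤_
  infixl 6 _+_
  infixl 7 _*_
  infix  8 -_
  field
    Carrier           : Set
    _≈_ _≤_           : Rel Carrier 0ℓ
    _+_ _*_           : Op₂ Carrier
    -_                : Op₁ Carrier
    0# 1#             : Carrier
    isCommutativeRing : IsCommutativeRing _≈_ _+_ _*_ -_ 0# 1#
    isDecTotalOrder   : IsDecTotalOrder _≈_ _≤_
    0≉1               : ¬ (0# ≈ 1#)
    inverse           : ∀ x → ¬ (x ≈ 0#) → ∃[ y ] x * y ≈ 1#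
    +-monoʳ-≤         : ∀ x {y z} → y ≤ z → x + y ≤ x + z
    *-nonneg          : ∀ {x y} → 0# ≤ x → 0# ≤ y → 0# ≤ x * y

  UpperBound : Pred Carrier 0ℓ → Carrier → Set
  UpperBound P u = ∀ x → P x → x ≤ u

  field
    supremum : (P : Pred Carrier 0ℓ) → ∃ P → ∃ (UpperBound P) →
               ∃[ s ] UpperBound P s × (∀ u → UpperBound P u → s ≤ u)

  commutativeRing : CommutativeRing 0ℓ 0ℓ
  commutativeRing = record { isCommutativeRing = isCommutativeRing }

  open IsDecTotalOrder isDecTotalOrder public using (_≟_; _≤?_)

record Graph (n : ℕ) : Set₁ where
  field
    Adj        : Rel (Fin n) 0ℓ
    adj-sym    : Symmetric Adj
    adj-irrefl : Irreflexive _≡_ Adj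

open Graph public

complement : ∀ {n} → Graph n → Graph n
complement G = record
  { Adj        = λ i j → i ≢ j × ¬ Adj G i j
  ; adj-sym    = λ (i≢j , ¬ij) → (λ j≡i → i≢j (sym j≡i)) , λ ji → ¬ij (adj-sym G ji)
  ; adj-irrefl = λ i≡j (i≢j , _) → i≢j i≡j
  }

IsLeast : Pred ℕ 0ℓ → ℕ → Set
IsLeast P m = P m × (∀ k → P k → m ℕ.≤ k)

Colourable : ∀ {n} → Graph n → ℕ → Set
Colourable {n} G k =
  Σ[ c ∈ (Fin n → Fin k) ] (∀ i j → Adj G i j → c i ≢ c j)

IsChromaticNumber : ∀ {n} → Graph n → ℕ → Set
IsChromaticNumber G = IsLeast (Colourable G)

module OverReals (ℝ : Reals) where
  open Reals ℝ
  open CommutativeRing commutativeRing using (semiring)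
  open SemiringSum semiring using (sum-syntax)
  open SemiringMult semiring using () renaming (_×_ to _·_)

  fromℤ : ℤ → Carrier
  fromℤ (+ n)    = n · 1#
  fromℤ -[1+ n ] = - (suc n · 1#)

  IsCeiling : Carrier → ℤ → Set
  IsCeiling x c = x ≤ fromℤ c × (∀ k → x ≤ fromℤ k → c ℤ.≤ k)

  Matrix : ℕ → Set
  Matrix n = Fin n → Fin n → Carrier

  infixl 7 _*ᴹ_ _*ⱽ_

  _*ᴹ_ : ∀ {n} → Matrix n → Matrix n → Matrix n
  _*ᴹ_ {n} A B i j = ∑[ k < n ] (A i k * B k j)

  _*ⱽ_ : ∀ {n} → Matrix n → Vector Carrier n → Vector Carrier n
  _*ⱽ_ {n} A v i = ∑[ j < n ] (A i j * v j)

  tr : ∀ {n} → Matrix n → Carrier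
  tr {n} A = ∑[ i < n ] A i i

  ⟨_,_⟩ : ∀ {n} → Matrix n → Matrix n → Carrier
  ⟨ A , B ⟩ = tr (A *ᴹ B)

  J : ∀ {n} → Matrix n
  J _ _ = 1#

  IsSymmetric : ∀ {n} → Matrix n → Set
  IsSymmetric A = ∀ i j → A i j ≈ A j i

  PositiveSemidefinite : ∀ {n} → Matrix n → Set
  PositiveSemidefinite {n} A =
    ∀ (v : Vector Carrier n) → 0# ≤ ∑[ i < n ] (v i * (A *ⱽ v) i)

  HasDimension : ∀ {n} → Pred (Vector Carrier n) 0ℓ → ℕ → Set
  HasDimension {n} S d = Σ[ b ∈ (Fin d → Vector Carrier n) ]
    (∀ j → S (b j)) ×
    (∀ (c : Vector Carrier d) →
      (∀ i → ∑[ j < d ] (c j * b j i) ≈ 0#) → ∀ j → c j ≈ 0#) ×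
    (∀ v → S v → Σ[ c ∈ Vector Carrier d ] (∀ i → v i ≈ ∑[ j < d ] (c j * b j i)))

  Eigenspace : ∀ {n} → Matrix n → Carrier → Pred (Vector Carrier n) 0ℓ
  Eigenspace A μ v = ∀ i → (A *ⱽ v) i ≈ μ * v i

  multiplicity : ∀ {n} → Vector Carrier n → Carrier → ℕ
  multiplicity {n} eig μ = length (filter (λ i → eig i ≟ μ) (allFin n))

  -- eig lists λ₁ ≥ … ≥ λₙ from index 0.  The multiplicity of μ is the dimension
  -- of its eigenspace, which is 0 if μ is not an eigenvalue; for the symmetric
  -- matrices considered here it agrees with the algebraic multiplicity.
  IsSpectrum : ∀ {n} → Matrix n → Vector Carrier n → Set
  IsSpectrum A eig = Antitonic₁ Fin._≤_ _≤_ eig ×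
    (∀ μ → HasDimension (Eigenspace A μ) (multiplicity eig μ))

  -- The inequality in the definition of h for m = suc k: the i-th summand
  -- (i counted from 0) is λ_{N-i}, where N = suc n is the number of vertices.
  -- The bound k ≤ N says that these eigenvalues exist.
  SpectralBound : ∀ {n} → Graph (suc n) → ℕ → Set
  SpectralBound     G zero    = ⊥
  SpectralBound {n} G (suc k) = Σ[ k≤N ∈ k ℕ.≤ suc n ]
    (∀ (Z : Matrix (suc n)) → IsSymmetric Z →
      (∀ i j → ¬ Adj G i j → Z i j ≈ 0#) →
      ∀ (eig : Vector Carrier (suc n)) → IsSpectrum Z eig →
      eig zero + ∑[ i < k ] eig (opposite (inject≤ i k≤N)) ≤ 0#)

  IsH : ∀ {n} → Graph (suc n) → ℕ → Set
  IsH G = IsLeast (SpectralBound G)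

  ThetaFeasible : ∀ {n} → Graph n → Matrix n → Set
  ThetaFeasible H X =
    IsSymmetric X ×
    tr X ≈ 1# ×
    (∀ i j → Adj H i j → X i j ≈ 0#) ×
    PositiveSemidefinite X

  IsLovászTheta : ∀ {n} → Graph n → Carrier → Set
  IsLovászTheta H t =
    (∃[ X ] ThetaFeasible H X × ⟨ J , X ⟩ ≈ t) ×
    (∀ X → ThetaFeasible H X → ⟨ J , X ⟩ ≤ t)

{-# OPTIONS --safe #-}
-- Upper bound.  Split a unit eigenvector x for λ₁ along the classes of a colouring with
-- χ nonempty classes and normalise the parts to orthonormal y_c.  Since Z vanishes inside
-- classes, y_cᵀZy_c = 0.  In an orthonormal eigenbasis uᵢ with u₁ = x the numbers
-- pᵢ = Σ_c (y_c·uᵢ)² lie in [0,1], sum to χ, satisfy p₁ = 1 and Σ λᵢpᵢ = 0; hence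
-- −λ₁ = Σ_{i>1} λᵢpᵢ is at least the sum of the χ − 1 smallest eigenvalues.
--
-- Lower bound.  For X feasible for ϑ, let D be its diagonal and Z = D^{-1/2} X D^{-1/2} − 1
-- (rows with Xᵢᵢ = 0 set to 0).  Every eigenvalue of Z is at least −1, and the unit vector
-- (√Xᵢᵢ) gives λ₁ ≥ ⟨J,X⟩ − 1, so the inequality defining h yields ⟨J,X⟩ − 1 ≤ h − 1.
--
-- The spectral theorem is built from the supremum axiom: the infimum of the Rayleigh
-- quotient is an eigenvalue, and deflation makes the eigenvectors orthogonal.
module Submission where

open import Defs
open import Level using (0ℓ)
open import Axiom.ExcludedMiddle using (ExcludedMiddle)
open import Algebra.Bundles using (CommutativeRing)
open import Algebra.Solver.Ring.AlmostCommutativeRing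
  using (fromCommutativeRing; _-Raw-AlmostCommutative⟶_)
import Algebra.Solver.Ring as RingSolver
import Algebra.Properties.Ring as RingProperties
import Algebra.Properties.Semiring.Mult as SemiringMult
import Algebra.Properties.Semiring.Mult.TCOptimised as Mult
import Algebra.Properties.Semiring.Sum as SemiringSum
open import Data.Fin.Base as Fin using (Fin; zero; suc; toℕ; fromℕ<; opposite; inject≤; punchOut)
import Data.Fin.Properties as Fin
import Data.Fin.Permutation as Perm
open import Data.Integer.Base as ℤ using (ℤ; +_; -[1+_]; _⊖_; _◃_)
import Data.Integer.Properties as ℤ
open import Data.List.Base using (List; []; _∷_; length; filter; allFin; tabulate; lookup)
open import Data.List.Membership.Propositional.Properties using (∈-lookup)
open import Data.List.Relation.Unary.All as All using ()
import Data.List.Relation.Unary.All.Properties as All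
open import Data.List.Relation.Unary.AllPairs using ([]; _∷_)
open import Data.List.Relation.Unary.Unique.Propositional using (Unique)
import Data.List.Relation.Unary.Unique.Propositional.Properties as Unique
open import Data.Maybe.Base using (Maybe; just; nothing)
open import Data.Nat.Base as ℕ using (ℕ; zero; suc)
import Data.Nat.Properties as ℕ
open import Data.Product.Base as Product using (∃; _×_; _,_; proj₁; proj₂; ∃-syntax; Σ-syntax)
open import Data.Sign.Base as Sign using (Sign)
open import Data.Sum.Base as Sum using (_⊎_; inj₁; inj₂)
open import Data.Vec.Functional using (Vector) renaming (_∷_ to _∷ᶠ_)
open import Function.Base using (_∘_; id; case_of_)
open import Relation.Nullary using (¬_; Dec; yes; no; contradiction)
open import Relation.Unary using (Pred; Decidable)
open import Relation.Binary.Definitions using (Antitonic₁; tri<; tri≈; tri>)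
open import Relation.Binary.PropositionalEquality.Core as ≡ using (_≡_; _≢_)
import Relation.Binary.Reasoning.Setoid as SetoidReasoning
open import Relation.Binary.Structures using (IsDecTotalOrder)

-- That the infimum is attained is proved without compactness: a positive semidefinite matrix is
-- either singular or coercive, by induction over Schur complements, and coercivity at the infimum
-- would let the infimum grow. The definition of `h` ranges over every `eig` with
-- `IsSpectrum Z eig`, so the two inequalities use different halves of the spectral theorem. The
-- lower bound uses existence, to have a spectrum to which the inequality defining `h` applies; the
-- upper bound uses uniqueness, to pass from the constructed eigenbasis to an arbitrary `eig`.
-- Multiplicities are dimensions of eigenspaces, so uniqueness rests on the invariance of dimension.
-- Nonempty colour classes matter twice: each class must carry a unit vector even if the eigenvector
-- vanishes on it, and choosing one vertex per class gives χ ≤ n, which supplies the bound on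
-- indices that `SpectralBound` asks for.

module IntegerCoefficients (R : CommutativeRing 0ℓ 0ℓ) where
  open CommutativeRing R
  open Mult semiring using (1+×; ×-homo-+; ×1-homo-*) renaming (_×_ to _·_)
  open RingProperties ring
  open SetoidReasoning setoid

  -- Integer coefficients have an equality test that computes, so the solver can cancel terms over
  -- an abstract carrier. With the optimised multiple, `con (+ 1)` reduces to `1#` and `con (+ 2)`
  -- to `1# + 1#`, so solved equations match goals containing these constants.
  ⟦_⟧ : ℤ → Carrier
  ⟦ + n ⟧      = n · 1#
  ⟦ -[1+ n ] ⟧ = - (suc n · 1#)

  -‿homo : ∀ i → ⟦ ℤ.- i ⟧ ≈ - ⟦ i ⟧
  -‿homo (+ zero)  = sym -0#≈0#
  -‿homo (+ suc n) = refl
  -‿homo -[1+ n ]  = sym (-‿involutive _)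

  ⊖-homo : ∀ m n → ⟦ m ⊖ n ⟧ ≈ m · 1# - n · 1#
  ⊖-homo m       zero    = sym (trans (+-congˡ -0#≈0#) (+-identityʳ _))
  ⊖-homo zero    (suc n) = sym (+-identityˡ _)
  ⊖-homo (suc m) (suc n) = begin
    ⟦ suc m ⊖ suc n ⟧                       ≡⟨ ≡.cong ⟦_⟧ (ℤ.[1+m]⊖[1+n]≡m⊖n m n) ⟩
    ⟦ m ⊖ n ⟧                               ≈⟨ ⊖-homo m n ⟩
    m · 1# - n · 1#                         ≈⟨ +-congʳ (+-identityʳ _) ⟨
    m · 1# + 0# - n · 1#                    ≈⟨ +-congʳ (+-congˡ (-‿inverseʳ 1#)) ⟨
    m · 1# + (1# - 1#) - n · 1#             ≈⟨ +-congʳ (+-assoc _ _ _) ⟨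
    m · 1# + 1# - 1# - n · 1#               ≈⟨ +-assoc _ _ _ ⟩
    m · 1# + 1# + (- 1# - n · 1#)           ≈⟨ +-cong (+-comm _ _) (-‿+-comm _ _) ⟩
    1# + m · 1# - (1# + n · 1#)             ≈⟨ +-cong (1+× m 1#) (-‿cong (1+× n 1#)) ⟨
    suc m · 1# - suc n · 1#                 ∎

  +-homo : ∀ i j → ⟦ i ℤ.+ j ⟧ ≈ ⟦ i ⟧ + ⟦ j ⟧
  +-homo (+ m)    (+ n)    = ×-homo-+ 1# m n
  +-homo (+ m)    -[1+ n ] = ⊖-homo m (suc n)
  +-homo -[1+ m ] (+ n)    = trans (⊖-homo n (suc m)) (+-comm _ _)
  +-homo -[1+ m ] -[1+ n ] = begin
    - (suc (suc (m ℕ.+ n)) · 1#)      ≈⟨ -‿cong (reflexive (≡.cong (λ k → suc k · 1#) (≡.sym (ℕ.+-suc m n)))) ⟩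
    - ((suc m ℕ.+ suc n) · 1#)        ≈⟨ -‿cong (×-homo-+ 1# (suc m) (suc n)) ⟩
    - (suc m · 1# + suc n · 1#)       ≈⟨ -‿+-comm _ _ ⟨
    - (suc m · 1#) - suc n · 1#       ∎

  ◃-homo⁺ : ∀ n → ⟦ Sign.+ ◃ n ⟧ ≈ n · 1#
  ◃-homo⁺ zero    = refl
  ◃-homo⁺ (suc n) = refl

  ◃-homo⁻ : ∀ n → ⟦ Sign.- ◃ n ⟧ ≈ - (n · 1#)
  ◃-homo⁻ zero    = sym -0#≈0#
  ◃-homo⁻ (suc n) = refl

  *-homo : ∀ i j → ⟦ i ℤ.* j ⟧ ≈ ⟦ i ⟧ * ⟦ j ⟧
  *-homo (+ m)    (+ n)    = trans (◃-homo⁺ (m ℕ.* n)) (×1-homo-* m n)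
  *-homo (+ m)    -[1+ n ] = trans (◃-homo⁻ (m ℕ.* suc n))
    (trans (-‿cong (×1-homo-* m (suc n))) (-‿distribʳ-* _ _))
  *-homo -[1+ m ] (+ n)    = trans (◃-homo⁻ (suc m ℕ.* n))
    (trans (-‿cong (×1-homo-* (suc m) n)) (-‿distribˡ-* _ _))
  *-homo -[1+ m ] -[1+ n ] = begin
    (suc m ℕ.* suc n) · 1#            ≈⟨ ×1-homo-* (suc m) (suc n) ⟩
    (suc m · 1#) * (suc n · 1#)       ≈⟨ -‿involutive _ ⟨
    - - ((suc m · 1#) * (suc n · 1#)) ≈⟨ -‿cong (-‿distribˡ-* _ _) ⟩
    - (- (suc m · 1#) * (suc n · 1#)) ≈⟨ -‿distribʳ-* _ _ ⟩
    - (suc m · 1#) * - (suc n · 1#)   ∎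

  morphism : ℤ.+-*-rawRing -Raw-AlmostCommutative⟶ fromCommutativeRing R
  morphism = record
    { ⟦_⟧ = ⟦_⟧ ; +-homo = +-homo ; *-homo = *-homo ; -‿homo = -‿homo
    ; 0-homo = refl ; 1-homo = refl }

  _coeff≟_ : ∀ i j → Maybe (⟦ i ⟧ ≈ ⟦ j ⟧)
  i coeff≟ j with i ℤ.≟ j
  ... | yes ≡.refl = just refl
  ... | no  _      = nothing

  open RingSolver ℤ.+-*-rawRing (fromCommutativeRing R) morphism _coeff≟_ public
    using (solve; _:=_; _:+_; _:*_; _:-_; :-_; con)

module Theory (ℝ : Reals) where
  open Reals ℝ
  open OverReals ℝ
  open CommutativeRing commutativeRing
    using (semiring; setoid; refl; sym; trans; +-cong; +-congˡ; +-congʳ; *-cong; *-congˡ; *-congʳ; -‿cong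
          ; +-comm; *-comm; *-assoc; +-identityʳ; +-identityˡ; *-identityʳ; *-identityˡ; zeroʳ; zeroˡ
          ; distribˡ; distribʳ; _-_)
  open SemiringSum semiring
    using (sum-syntax; sum-cong-≋; sum-replicate-zero; sum-replicate; ∑-distrib-+; ∑-comm; ∑-permute; *-distribˡ-sum; *-distribʳ-sum)
  open SemiringMult semiring using () renaming (_×_ to _·_)
  open IsDecTotalOrder isDecTotalOrder using (antisym; total)
    renaming (refl to ≤-refl; trans to ≤-trans; reflexive to ≤-reflexive)
  open IntegerCoefficients commutativeRing using (solve; _:=_; _:+_; _:*_; _:-_; :-_; con)

  module ≈-R = SetoidReasoning setoid

  -- Ordered-field arithmetic and square roots

  ≤-resp : ∀ {x x′ y y′} → x ≈ x′ → y ≈ y′ → x ≤ y → x′ ≤ y′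
  ≤-resp p q x≤y = ≤-trans (≤-reflexive (sym p)) (≤-trans x≤y (≤-reflexive q))

  +-mono-≤ : ∀ {x y u v} → x ≤ y → u ≤ v → x + u ≤ y + v
  +-mono-≤ {x} {y} {u} {v} x≤y u≤v =
    ≤-trans (+-monoʳ-≤ x u≤v) (≤-resp (+-comm v x) (+-comm v y) (+-monoʳ-≤ v x≤y))

  +-nonneg : ∀ {x y} → 0# ≤ x → 0# ≤ y → 0# ≤ x + y
  +-nonneg p q = ≤-trans (≤-reflexive (sym (+-identityʳ 0#))) (+-mono-≤ p q)

  ≤⇒0≤- : ∀ {x y} → x ≤ y → 0# ≤ y - x
  ≤⇒0≤- {x} {y} x≤y = ≤-resp (solve 1 (λ x → :- x :+ x := con (+ 0)) refl x) (+-comm _ _) (+-monoʳ-≤ (- x) x≤y)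

  0≤-⇒≤ : ∀ {x y} → 0# ≤ y - x → x ≤ y
  0≤-⇒≤ {x} {y} p = ≤-resp (+-identityʳ x) (solve 2 (λ x y → x :+ (y :- x) := y) refl x y) (+-monoʳ-≤ x p)

  ≤+nonneg : ∀ {x y d} → 0# ≤ d → y ≈ x + d → x ≤ y
  ≤+nonneg {x} p eq = ≤-resp (+-identityʳ x) (sym eq) (+-monoʳ-≤ x p)

  neg-nonneg : ∀ {x} → x ≤ 0# → 0# ≤ - x
  neg-nonneg {x} p = ≤-trans (≤⇒0≤- p) (≤-reflexive (+-identityˡ _))

  *-monoˡ : ∀ {c x y} → 0# ≤ c → x ≤ y → c * x ≤ c * y
  *-monoˡ {c} {x} {y} 0≤c x≤y = ≤+nonneg (*-nonneg 0≤c (≤⇒0≤- x≤y))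
    (solve 3 (λ c x y → c :* y := c :* x :+ c :* (y :- x)) refl c x y)

  *-monoʳ : ∀ {c x y} → 0# ≤ c → x ≤ y → x * c ≤ y * c
  *-monoʳ 0≤c x≤y = ≤-resp (*-comm _ _) (*-comm _ _) (*-monoˡ 0≤c x≤y)

  sq-nonneg : ∀ x → 0# ≤ x * x
  sq-nonneg x with total 0# x
  ... | inj₁ p = *-nonneg p p
  ... | inj₂ p = ≤-trans (*-nonneg (neg-nonneg p) (neg-nonneg p))
                   (≤-reflexive (solve 1 (λ x → :- x :* :- x := x :* x) refl x))

  0≤1 : 0# ≤ 1#
  0≤1 = ≤-trans (sq-nonneg 1#) (≤-reflexive (*-identityʳ 1#))

  infix 4 _<_
  _<_ : Carrier → Carrier → Set
  x < y = ¬ (y ≤ x)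

  <⇒≤ : ∀ {x y} → x < y → x ≤ y
  <⇒≤ {x} {y} x<y with total x y
  ... | inj₁ p = p
  ... | inj₂ p = contradiction p x<y

  <⇒≉ : ∀ {x y} → x < y → ¬ (y ≈ x)
  <⇒≉ x<y eq = x<y (≤-reflexive eq)

  ≤∧≉⇒< : ∀ {x y} → x ≤ y → ¬ (y ≈ x) → x < y
  ≤∧≉⇒< x≤y ne y≤x = ne (antisym y≤x x≤y)

  <-≤-trans : ∀ {x y z} → x < y → y ≤ z → x < z
  <-≤-trans x<y y≤z z≤x = x<y (≤-trans y≤z z≤x)

  0<1 : 0# < 1#
  0<1 = ≤∧≉⇒< 0≤1 (λ eq → 0≉1 (sym eq))

  0<1+ : ∀ {x} → 0# ≤ x → 0# < 1# + x
  0<1+ {x} p = <-≤-trans 0<1 (≤+nonneg p refl)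

  x≉0⇒y≈0 : ∀ {x y} → ¬ (x ≈ 0#) → x * y ≈ 0# → y ≈ 0#
  x≉0⇒y≈0 {x} {y} x≉0 xy≈0 with inverse x x≉0
  ... | z , xz≈1 = begin
    y              ≈⟨ *-identityˡ y ⟨
    1# * y         ≈⟨ *-congʳ xz≈1 ⟨
    (x * z) * y    ≈⟨ solve 3 (λ x y z → x :* z :* y := z :* (x :* y)) refl x y z ⟩
    z * (x * y)    ≈⟨ *-congˡ xy≈0 ⟩
    z * 0#         ≈⟨ zeroʳ z ⟩
    0#             ∎ where open ≈-R

  sq≈0 : ∀ {x} → x * x ≈ 0# → x ≈ 0#
  sq≈0 {x} p with x ≟ 0#
  ... | yes q = q
  ... | no  q = x≉0⇒y≈0 q p

  inverse-pos : ∀ {x} → 0# < x → ∃[ y ] (0# ≤ y × x * y ≈ 1#)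
  inverse-pos {x} 0<x with inverse x (<⇒≉ 0<x)
  ... | y , xy≈1 with total 0# y
  ... | inj₁ 0≤y = y , 0≤y , xy≈1
  ... | inj₂ y≤0 = contradiction (≤-resp xy≈1 (zeroʳ x) (*-monoˡ (<⇒≤ 0<x) y≤0)) 0<1

  *-cancelˡ-≤ : ∀ {c x y} → 0# < c → c * x ≤ c * y → x ≤ y
  *-cancelˡ-≤ {c} {x} {y} 0<c p with inverse-pos 0<c
  ... | d , 0≤d , cd≈1 = ≤-resp (eq x) (eq y) (*-monoˡ 0≤d p)
    where
    eq : ∀ z → d * (c * z) ≈ z
    eq z = trans (solve 3 (λ d c z → d :* (c :* z) := c :* d :* z) refl d c z)
                 (trans (*-congʳ cd≈1) (*-identityˡ z))

  *-pos : ∀ {x y} → 0# < x → 0# < y → 0# < x * y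
  *-pos {x} {y} 0<x 0<y xy≤0 = 0<y (*-cancelˡ-≤ 0<x (≤-trans xy≤0 (≤-reflexive (sym (zeroʳ x)))))

  -- Otherwise `x - y` and `x + y` are both positive, and so is their product x² - y².
  sq-cancel-≤ : ∀ {x y} → 0# ≤ y → x * x ≤ y * y → x ≤ y
  sq-cancel-≤ {x} {y} 0≤y p with x ≤? y
  ... | yes q = q
  ... | no  x≰y = contradiction p λ x²≤y² →
    *-pos {x - y} {x + y} (λ q → x≰y (≤-resp (solve 2 (λ x y → y :+ (x :- y) := x) refl x y) (+-identityʳ y) (+-monoʳ-≤ y q)))
      (<-≤-trans (λ x≤0 → x≰y (≤-trans x≤0 0≤y)) (≤+nonneg 0≤y refl))
      (≤-resp (solve 2 (λ x y → :- (y :* y) :+ x :* x := (x :- y) :* (x :+ y)) refl x y)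
              (solve 1 (λ y → :- (y :* y) :+ y :* y := con (+ 0)) refl y)
              (+-monoʳ-≤ (- (y * y)) x²≤y²))

  -- Avoids dividing by two: if `x ≤ 0#`, then `x + x ≤ x`, so `x` dominates a nonnegative number.
  half-nonneg : ∀ {x} → 0# ≤ x + x → 0# ≤ x
  half-nonneg {x} p with total 0# x
  ... | inj₁ q = q
  ... | inj₂ q = ≤-trans p (≤-resp refl (+-identityʳ x) (+-monoʳ-≤ x q))

  -- The supremum s of {x | x² ≤ a} is the root: s² > a would make s − (s² − a)/2s
  -- an upper bound, and s² < a would put s + ε into the set for small ε.
  sqrt : ∀ {a} → 0# ≤ a → ∃[ s ] (0# ≤ s × s * s ≈ a)
  sqrt {a} 0≤a with supremum (λ x → x * x ≤ a) (0# , ≤-trans (≤-reflexive (zeroˡ 0#)) 0≤a) (1# + a , bounded)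
    where
    bounded : ∀ x → x * x ≤ a → x ≤ 1# + a
    bounded x x²≤a = sq-cancel-≤ (+-nonneg 0≤1 0≤a) (≤-trans x²≤a
      (≤+nonneg (+-nonneg 0≤1 (+-nonneg 0≤a (sq-nonneg a)))
        (solve 1 (λ a → (con (+ 1) :+ a) :* (con (+ 1) :+ a) := a :+ (con (+ 1) :+ (a :+ a :* a))) refl a)))
  ... | s , ub , least = s , 0≤s , antisym s²≤a a≤s²
    where
    0≤s : 0# ≤ s
    0≤s = ub 0# (≤-trans (≤-reflexive (zeroˡ 0#)) 0≤a)

    s²≤a : s * s ≤ a
    s²≤a with s * s ≤? a
    ... | yes p = p
    ... | no  a<s² = contradiction (least (s - ε) ub′) s≰s-ε
      where
      0<s : 0# < s
      0<s s≤0 = a<s² (≤-trans (≤-reflexive (trans (*-cong s≈0 s≈0) (zeroˡ 0#))) 0≤a)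
        where s≈0 = antisym s≤0 0≤s
      0<2s : 0# < s + s
      0<2s = <-≤-trans 0<s (≤+nonneg 0≤s refl)
      d = s * s - a
      0<d : 0# < d
      0<d d≤0 = a<s² (≤-resp (solve 2 (λ s a → a :+ (s :* s :- a) := s :* s) refl s a) (+-identityʳ a) (+-monoʳ-≤ a d≤0))
      inv = inverse-pos 0<2s
      y = proj₁ inv
      0<y : 0# < y
      0<y y≤0 = 0<1 (≤-resp (proj₂ (proj₂ inv)) (zeroʳ (s + s)) (*-monoˡ (<⇒≤ 0<2s) y≤0))
      ε = d * y
      0<ε : 0# < ε
      0<ε = *-pos 0<d 0<y
      2sε≈d : (s + s) * ε ≈ d
      2sε≈d = trans (solve 3 (λ s d y → (s :+ s) :* (d :* y) := d :* ((s :+ s) :* y)) refl s d y)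
                    (trans (*-congˡ (proj₂ (proj₂ inv))) (*-identityʳ d))
      s≰s-ε : ¬ (s ≤ s - ε)
      s≰s-ε p = 0<ε (≤-resp (solve 2 (λ s e → e :- s :+ s := e) refl s ε)
                            (solve 2 (λ s e → e :- s :+ (s :- e) := con (+ 0)) refl s ε) (+-monoʳ-≤ (ε - s) p))
      -- Comparing squares requires a nonnegative candidate; here 2s(s - ε) = s² + a.
      0≤s-ε : 0# ≤ s - ε
      0≤s-ε = *-cancelˡ-≤ 0<2s (≤+nonneg (+-nonneg (sq-nonneg s) 0≤a) (begin
        (s + s) * (s - ε)                ≈⟨ solve 2 (λ s e → (s :+ s) :* (s :- e) := (s :+ s) :* s :- (s :+ s) :* e) refl s ε ⟩
        (s + s) * s - (s + s) * ε        ≈⟨ +-congˡ (-‿cong 2sε≈d) ⟩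
        (s + s) * s - (s * s - a)        ≈⟨ solve 2 (λ s a → (s :+ s) :* s :- (s :* s :- a) := (s :+ s) :* con (+ 0) :+ (s :* s :+ a)) refl s a ⟩
        (s + s) * 0# + (s * s + a)       ∎)) where open ≈-R
      ub′ : ∀ x → x * x ≤ a → x ≤ s - ε
      ub′ x x²≤a = sq-cancel-≤ 0≤s-ε (≤-trans x²≤a (≤+nonneg (sq-nonneg ε) (begin
        (s - ε) * (s - ε)                  ≈⟨ solve 2 (λ s e → (s :- e) :* (s :- e) := s :* s :- (s :+ s) :* e :+ e :* e) refl s ε ⟩
        s * s - (s + s) * ε + ε * ε        ≈⟨ +-congʳ (+-congˡ (-‿cong 2sε≈d)) ⟩
        s * s - (s * s - a) + ε * ε        ≈⟨ solve 3 (λ s a e → s :* s :- (s :* s :- a) :+ e :* e := a :+ e :* e) refl s a ε ⟩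
        a + ε * ε                          ∎))) where open ≈-R

    a≤s² : a ≤ s * s
    a≤s² with a ≤? s * s
    ... | yes p = p
    ... | no  s²<a = contradiction (ub (s + ε) in-set) s+ε≰s
      where
      d = a - s * s
      0<d : 0# < d
      0<d d≤0 = s²<a (≤-resp (solve 2 (λ s a → s :* s :+ (a :- s :* s) := a) refl s a) (+-identityʳ _) (+-monoʳ-≤ (s * s) d≤0))
      -- For ε = d/e the summand 1 + d gives ε ≤ 1, and a - (s + ε)² becomes ε(1 - ε + d), a product
      -- of nonnegative factors.
      e = 1# + (s + s + d)
      0≤2s+d : 0# ≤ s + s + d
      0≤2s+d = +-nonneg (+-nonneg 0≤s 0≤s) (<⇒≤ 0<d)
      0<e : 0# < e
      0<e = 0<1+ 0≤2s+d
      inv = inverse-pos 0<e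
      y = proj₁ inv
      ey≈1 = proj₂ (proj₂ inv)
      0<y : 0# < y
      0<y y≤0 = 0<1 (≤-resp ey≈1 (zeroʳ e) (*-monoˡ (<⇒≤ 0<e) y≤0))
      ε = d * y
      eε≈d : e * ε ≈ d
      eε≈d = trans (solve 3 (λ e d y → e :* (d :* y) := d :* (e :* y)) refl e d y)
                   (trans (*-congˡ ey≈1) (*-identityʳ d))
      ε≤1 : ε ≤ 1#
      ε≤1 = *-cancelˡ-≤ 0<e (≤-trans (≤-reflexive eε≈d) (≤+nonneg (+-nonneg 0≤1 (+-nonneg 0≤s 0≤s))
        (solve 2 (λ s d → (con (+ 1) :+ (s :+ s :+ d)) :* con (+ 1) := d :+ (con (+ 1) :+ (s :+ s))) refl s d)))
      0<ε : 0# < ε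
      0<ε = *-pos 0<d 0<y
      s+ε≰s : ¬ (s + ε ≤ s)
      s+ε≰s p = 0<ε (≤-resp (solve 2 (λ s e → :- s :+ (s :+ e) := e) refl s ε)
                            (solve 1 (λ s → :- s :+ s := con (+ 0)) refl s) (+-monoʳ-≤ (- s) p))
      in-set : (s + ε) * (s + ε) ≤ a
      in-set = ≤+nonneg (*-nonneg (<⇒≤ 0<ε) (+-nonneg (≤⇒0≤- ε≤1) (<⇒≤ 0<d))) (begin
        a                                                   ≈⟨ solve 2 (λ s a → a := s :* s :+ (a :- s :* s)) refl s a ⟩
        s * s + d                                           ≈⟨ +-congˡ eε≈d ⟨
        s * s + e * ε                                       ≈⟨ solve 3 (λ s d e → s :* s :+ (con (+ 1) :+ (s :+ s :+ d)) :* e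
                                                                 := (s :+ e) :* (s :+ e) :+ e :* (con (+ 1) :- e :+ d)) refl s d ε ⟩
        (s + ε) * (s + ε) + ε * (1# - ε + d)                ∎) where open ≈-R

  -- Sums, inner products and orthonormal families

  ∑-zero : ∀ {n} {f : Vector Carrier n} → (∀ i → f i ≈ 0#) → ∑[ i < n ] f i ≈ 0#
  ∑-zero {n} p = trans (sum-cong-≋ p) (sum-replicate-zero n)

  ∑-mono-≤ : ∀ {n} {f g : Vector Carrier n} → (∀ i → f i ≤ g i) → ∑[ i < n ] f i ≤ ∑[ i < n ] g i
  ∑-mono-≤ {zero}  p = ≤-refl
  ∑-mono-≤ {suc n} p = +-mono-≤ (p zero) (∑-mono-≤ (p ∘ suc))

  ∑-nonneg : ∀ {n} {f : Vector Carrier n} → (∀ i → 0# ≤ f i) → 0# ≤ ∑[ i < n ] f i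
  ∑-nonneg {n} p = ≤-trans (≤-reflexive (sym (sum-replicate-zero n))) (∑-mono-≤ p)

  ≤-∑ : ∀ {n} {f : Vector Carrier n} → (∀ i → 0# ≤ f i) → ∀ i → f i ≤ ∑[ j < n ] f j
  ≤-∑ p zero    = ≤+nonneg (∑-nonneg (p ∘ suc)) refl
  ≤-∑ p (suc i) = ≤-trans (≤-∑ (p ∘ suc) i) (≤+nonneg (p zero) (+-comm _ _))

  ∑≈0⇒≈0 : ∀ {n} {f : Vector Carrier n} → (∀ i → 0# ≤ f i) → ∑[ i < n ] f i ≈ 0# → ∀ i → f i ≈ 0#
  ∑≈0⇒≈0 p eq i = antisym (≤-trans (≤-∑ p i) (≤-reflexive eq)) (p i)

  ∑-distrib-- : ∀ {n} (f g : Vector Carrier n) →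
                ∑[ i < n ] (f i - g i) ≈ ∑[ i < n ] f i - ∑[ i < n ] g i
  ∑-distrib-- {zero}  f g = solve 0 (con (+ 0) := con (+ 0) :- con (+ 0)) refl
  ∑-distrib-- {suc n} f g = trans (+-congˡ (∑-distrib-- (f ∘ suc) (g ∘ suc)))
    (solve 4 (λ a b c d → a :- b :+ (c :- d) := a :+ c :- (b :+ d)) refl _ _ _ _)

  -- The identity matrix, whose row `δ i` also serves as the i-th standard basis vector. Structural
  -- recursion instead of a decision of equality makes sums against it plain inductions.
  δ : ∀ {n} → Fin n → Fin n → Carrier
  δ zero    zero    = 1#
  δ zero    (suc j) = 0#
  δ (suc i) zero    = 0#
  δ (suc i) (suc j) = δ i j

  δ-refl : ∀ {n} (i : Fin n) → δ i i ≈ 1#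
  δ-refl zero    = refl
  δ-refl (suc i) = δ-refl i

  δ-≢ : ∀ {n} {i j : Fin n} → i ≢ j → δ i j ≈ 0#
  δ-≢ {i = zero}  {zero}  i≢j = contradiction ≡.refl i≢j
  δ-≢ {i = zero}  {suc j} i≢j = refl
  δ-≢ {i = suc i} {zero}  i≢j = refl
  δ-≢ {i = suc i} {suc j} i≢j = δ-≢ (i≢j ∘ ≡.cong suc)

  δ-comm : ∀ {n} (i j : Fin n) → δ i j ≈ δ j i
  δ-comm zero    zero    = refl
  δ-comm zero    (suc j) = refl
  δ-comm (suc i) zero    = refl
  δ-comm (suc i) (suc j) = δ-comm i j

  ∑-δˡ : ∀ {n} (i : Fin n) (f : Vector Carrier n) → ∑[ j < n ] (δ i j * f j) ≈ f i
  ∑-δˡ zero    f = trans (+-cong (*-identityˡ _) (∑-zero (λ j → zeroˡ (f (suc j))))) (+-identityʳ _)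
  ∑-δˡ (suc i) f = trans (+-cong (zeroˡ _) (∑-δˡ i (f ∘ suc))) (+-identityˡ _)

  ∑-δʳ : ∀ {n} (i : Fin n) (f : Vector Carrier n) → ∑[ j < n ] (f j * δ j i) ≈ f i
  ∑-δʳ i f = trans (sum-cong-≋ (λ j → trans (*-comm _ _) (*-congʳ (δ-comm j i)))) (∑-δˡ i f)

  infix 4 _≈ⱽ_
  _≈ⱽ_ : ∀ {n} → Vector Carrier n → Vector Carrier n → Set
  u ≈ⱽ v = ∀ i → u i ≈ v i

  infixl 6 _+ⱽ_
  _+ⱽ_ : ∀ {n} → Vector Carrier n → Vector Carrier n → Vector Carrier n
  (u +ⱽ v) i = u i + v i

  infixl 7 _⊛_
  _⊛_ : ∀ {n} → Carrier → Vector Carrier n → Vector Carrier n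
  (a ⊛ v) i = a * v i

  combination : ∀ {n d} → Vector Carrier d → (Fin d → Vector Carrier n) → Vector Carrier n
  combination {d = d} c b i = ∑[ j < d ] (c j * b j i)

  infix 7 _∙_
  _∙_ : ∀ {n} → Vector Carrier n → Vector Carrier n → Carrier
  _∙_ {n} u v = ∑[ i < n ] (u i * v i)

  ∙-cong : ∀ {n} {u u′ v v′ : Vector Carrier n} → u ≈ⱽ u′ → v ≈ⱽ v′ → u ∙ v ≈ u′ ∙ v′
  ∙-cong p q = sum-cong-≋ (λ i → *-cong (p i) (q i))

  ∙-congˡ : ∀ {n} (u : Vector Carrier n) {v v′} → v ≈ⱽ v′ → u ∙ v ≈ u ∙ v′
  ∙-congˡ u = ∙-cong {u = u} (λ _ → refl)

  ∙-comm : ∀ {n} (u v : Vector Carrier n) → u ∙ v ≈ v ∙ u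
  ∙-comm u v = sum-cong-≋ (λ i → *-comm (u i) (v i))

  ∙-+ʳ : ∀ {n} (u v w : Vector Carrier n) → u ∙ (v +ⱽ w) ≈ u ∙ v + u ∙ w
  ∙-+ʳ u v w = trans (sum-cong-≋ (λ i → distribˡ (u i) (v i) (w i))) (∑-distrib-+ (λ i → u i * v i) (λ i → u i * w i))

  ∙-⊛ʳ : ∀ {n} (u : Vector Carrier n) a v → u ∙ (a ⊛ v) ≈ a * (u ∙ v)
  ∙-⊛ʳ u a v = trans (sum-cong-≋ (λ i → solve 3 (λ a x y → x :* (a :* y) := a :* (x :* y)) refl a (u i) (v i)))
                     (sym (*-distribˡ-sum a (λ i → u i * v i)))

  ∙-+ˡ : ∀ {n} (u v w : Vector Carrier n) → (u +ⱽ v) ∙ w ≈ u ∙ w + v ∙ w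
  ∙-+ˡ u v w = trans (∙-comm (u +ⱽ v) w) (trans (∙-+ʳ w u v) (+-cong (∙-comm w u) (∙-comm w v)))

  ∙-⊛ˡ : ∀ {n} a (u v : Vector Carrier n) → (a ⊛ u) ∙ v ≈ a * (u ∙ v)
  ∙-⊛ˡ a u v = trans (∙-comm (a ⊛ u) v) (trans (∙-⊛ʳ v a u) (*-congˡ (∙-comm v u)))

  ∙-combination : ∀ {n d} (u : Vector Carrier n) (c : Vector Carrier d) b →
                  u ∙ combination c b ≈ ∑[ j < d ] (c j * (u ∙ b j))
  ∙-combination {n} {d} u c b = begin
    ∑[ i < n ] (u i * ∑[ j < d ] (c j * b j i))      ≈⟨ sum-cong-≋ (λ i → *-distribˡ-sum (u i) (λ j → c j * b j i)) ⟩
    ∑[ i < n ] ∑[ j < d ] (u i * (c j * b j i))      ≈⟨ ∑-comm (λ i j → u i * (c j * b j i)) ⟩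
    ∑[ j < d ] ∑[ i < n ] (u i * (c j * b j i))      ≈⟨ sum-cong-≋ (λ j → ∙-⊛ʳ u (c j) (b j)) ⟩
    ∑[ j < d ] (c j * (u ∙ b j))                     ∎ where open ≈-R

  combination-∙ : ∀ {n d} (c : Vector Carrier d) b (u : Vector Carrier n) →
                  combination c b ∙ u ≈ ∑[ j < d ] (c j * (b j ∙ u))
  combination-∙ c b u = trans (∙-comm (combination c b) u) (trans (∙-combination u c b)
    (sum-cong-≋ (λ j → *-congˡ {c j} (∙-comm u (b j)))))

  ∙-nonneg : ∀ {n} (v : Vector Carrier n) → 0# ≤ v ∙ v
  ∙-nonneg v = ∑-nonneg (λ i → sq-nonneg (v i))

  ∙≈0⇒≈0 : ∀ {n} (v : Vector Carrier n) → v ∙ v ≈ 0# → ∀ i → v i ≈ 0#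
  ∙≈0⇒≈0 v eq i = sq≈0 (∑≈0⇒≈0 (λ j → sq-nonneg (v j)) eq i)

  sq≤∙ : ∀ {n} (v : Vector Carrier n) i → v i * v i ≤ v ∙ v
  sq≤∙ v = ≤-∑ (λ i → sq-nonneg (v i))

  δ-∙ : ∀ {n} (i : Fin n) v → δ i ∙ v ≈ v i
  δ-∙ = ∑-δˡ

  *ⱽ-cong : ∀ {n} (A : Matrix n) {v w} → v ≈ⱽ w → A *ⱽ v ≈ⱽ A *ⱽ w
  *ⱽ-cong A p i = ∙-congˡ (A i) p

  *ⱽ-+ : ∀ {n} (A : Matrix n) v w → A *ⱽ (v +ⱽ w) ≈ⱽ A *ⱽ v +ⱽ A *ⱽ w
  *ⱽ-+ A v w i = ∙-+ʳ (A i) v w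

  *ⱽ-⊛ : ∀ {n} (A : Matrix n) a v → A *ⱽ (a ⊛ v) ≈ⱽ a ⊛ (A *ⱽ v)
  *ⱽ-⊛ A a v i = ∙-⊛ʳ (A i) a v

  *ⱽ-δ : ∀ {n} (A : Matrix n) j i → (A *ⱽ δ j) i ≈ A i j
  *ⱽ-δ A j i = trans (∙-comm (A i) (δ j)) (δ-∙ j (A i))

  δ-quadratic : ∀ {n} (A : Matrix n) i → δ i ∙ (A *ⱽ δ i) ≈ A i i
  δ-quadratic A i = trans (δ-∙ i (A *ⱽ δ i)) (*ⱽ-δ A i i)

  δ-norm : ∀ {n} (i : Fin n) → δ i ∙ δ i ≈ 1#
  δ-norm i = trans (δ-∙ i (δ i)) (δ-refl i)

  symmetric-∙ : ∀ {n} {A : Matrix n} → IsSymmetric A → ∀ u v → u ∙ (A *ⱽ v) ≈ v ∙ (A *ⱽ u)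
  symmetric-∙ {n} {A} A-sym u v = begin
    u ∙ (A *ⱽ v)                                      ≈⟨ sum-cong-≋ (λ i → *-distribˡ-sum (u i) (λ j → A i j * v j)) ⟩
    ∑[ i < n ] ∑[ j < n ] (u i * (A i j * v j))       ≈⟨ ∑-comm (λ i j → u i * (A i j * v j)) ⟩
    ∑[ j < n ] ∑[ i < n ] (u i * (A i j * v j))       ≈⟨ sum-cong-≋ (λ j → sum-cong-≋ (λ i → trans (*-congˡ (*-congʳ (A-sym i j)))
                                                           (solve 3 (λ u a v → u :* (a :* v) := v :* (a :* u)) refl (u i) (A j i) (v j)))) ⟩
    ∑[ j < n ] ∑[ i < n ] (v j * (A j i * u i))       ≈⟨ sum-cong-≋ (λ j → *-distribˡ-sum (v j) (λ i → A j i * u i)) ⟨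
    v ∙ (A *ⱽ u)                                      ∎ where open ≈-R

  quadratic-+ : ∀ {n} {A : Matrix n} → IsSymmetric A → ∀ t u v →
                (t ⊛ u +ⱽ v) ∙ (A *ⱽ (t ⊛ u +ⱽ v)) ≈
                t * t * (u ∙ (A *ⱽ u)) + (t + t) * (u ∙ (A *ⱽ v)) + v ∙ (A *ⱽ v)
  quadratic-+ {n} {A} A-sym t u v = begin
    (t ⊛ u +ⱽ v) ∙ (A *ⱽ (t ⊛ u +ⱽ v))              ≈⟨ ∙-congˡ (t ⊛ u +ⱽ v) (λ i → trans (*ⱽ-+ A (t ⊛ u) v i) (+-congʳ (*ⱽ-⊛ A t u i))) ⟩
    (t ⊛ u +ⱽ v) ∙ (t ⊛ (A *ⱽ u) +ⱽ A *ⱽ v)         ≈⟨ ∙-+ʳ (t ⊛ u +ⱽ v) (t ⊛ (A *ⱽ u)) (A *ⱽ v) ⟩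
    (t ⊛ u +ⱽ v) ∙ (t ⊛ (A *ⱽ u)) + (t ⊛ u +ⱽ v) ∙ (A *ⱽ v)
      ≈⟨ +-cong (trans (∙-⊛ʳ (t ⊛ u +ⱽ v) t (A *ⱽ u)) (*-congˡ (split (A *ⱽ u)))) (split (A *ⱽ v)) ⟩
    t * (t * (u ∙ (A *ⱽ u)) + v ∙ (A *ⱽ u)) + (t * (u ∙ (A *ⱽ v)) + v ∙ (A *ⱽ v))
      ≈⟨ +-congʳ (*-congˡ (+-congˡ (symmetric-∙ {A = A} A-sym v u))) ⟩
    t * (t * (u ∙ (A *ⱽ u)) + u ∙ (A *ⱽ v)) + (t * (u ∙ (A *ⱽ v)) + v ∙ (A *ⱽ v))
      ≈⟨ solve 4 (λ t a b c → t :* (t :* a :+ b) :+ (t :* b :+ c) := t :* t :* a :+ (t :+ t) :* b :+ c) refl t _ _ _ ⟩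
    t * t * (u ∙ (A *ⱽ u)) + (t + t) * (u ∙ (A *ⱽ v)) + v ∙ (A *ⱽ v) ∎
    where
    open ≈-R
    split : ∀ w → (t ⊛ u +ⱽ v) ∙ w ≈ t * (u ∙ w) + v ∙ w
    split w = trans (∙-+ˡ (t ⊛ u) v w) (+-congʳ (∙-⊛ˡ t u w))

  norm-+ : ∀ {n} s t (u v : Vector Carrier n) →
           (s ⊛ u +ⱽ t ⊛ v) ∙ (s ⊛ u +ⱽ t ⊛ v) ≈ s * s * (u ∙ u) + (s + s) * t * (u ∙ v) + t * t * (v ∙ v)
  norm-+ s t u v = begin
    w ∙ w                                               ≈⟨ trans (split w) (+-cong (*-congˡ (trans (∙-comm u w) (split u))) (*-congˡ (trans (∙-comm v w) (split v)))) ⟩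
    s * (s * (u ∙ u) + t * (v ∙ u)) + t * (s * (u ∙ v) + t * (v ∙ v)) ≈⟨ +-congʳ (*-congˡ (+-congˡ (*-congˡ (∙-comm v u)))) ⟩
    s * (s * (u ∙ u) + t * (u ∙ v)) + t * (s * (u ∙ v) + t * (v ∙ v))
      ≈⟨ solve 5 (λ s t a b c → s :* (s :* a :+ t :* b) :+ t :* (s :* b :+ t :* c) := s :* s :* a :+ (s :+ s) :* t :* b :+ t :* t :* c) refl s t _ _ _ ⟩
    s * s * (u ∙ u) + (s + s) * t * (u ∙ v) + t * t * (v ∙ v) ∎
    where
    open ≈-R
    w = s ⊛ u +ⱽ t ⊛ v
    split : ∀ x → w ∙ x ≈ s * (u ∙ x) + t * (v ∙ x)
    split x = trans (∙-+ˡ (s ⊛ u) (t ⊛ v) x) (+-cong (∙-⊛ˡ s u x) (∙-⊛ˡ t v x))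

  -- For v ≠ 0 the vector (v∙v)u - (u∙v)v has squared norm (v∙v)((u∙u)(v∙v) - (u∙v)²), and the
  -- positive factor v∙v cancels.
  cauchy-schwarz : ∀ {n} (u v : Vector Carrier n) → (u ∙ v) * (u ∙ v) ≤ (u ∙ u) * (v ∙ v)
  cauchy-schwarz u v with v ∙ v ≟ 0#
  ... | yes eq = ≤-reflexive (begin
    (u ∙ v) * (u ∙ v)   ≈⟨ *-congˡ (∑-zero (λ i → trans (*-congˡ (∙≈0⇒≈0 v eq i)) (zeroʳ _))) ⟩
    (u ∙ v) * 0#        ≈⟨ trans (zeroʳ _) (sym (zeroʳ _)) ⟩
    (u ∙ u) * 0#        ≈⟨ *-congˡ eq ⟨
    (u ∙ u) * (v ∙ v)   ∎) where open ≈-R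
  ... | no ne = *-cancelˡ-≤ (≤∧≉⇒< (∙-nonneg v) ne) (0≤-⇒≤ (≤-trans (∙-nonneg w) (≤-reflexive
    (trans (norm-+ (v ∙ v) (- (u ∙ v)) u v)
      (solve 3 (λ a b c → c :* c :* a :+ (c :+ c) :* :- b :* b :+ :- b :* :- b :* c := c :* (a :* c) :- c :* (b :* b)) refl _ _ _)))))
    where w = (v ∙ v) ⊛ u +ⱽ (- (u ∙ v)) ⊛ v

  -- `α` is the norm and `β` its inverse; `α` is returned too, because `direction` recovers `v` as
  -- α(βv).
  normalise : ∀ {n} (v : Vector Carrier n) → ¬ (v ∙ v ≈ 0#) →
              Σ[ α ∈ Carrier ] Σ[ β ∈ Carrier ] (α * β ≈ 1# × (β ⊛ v) ∙ (β ⊛ v) ≈ 1#)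
  normalise v ne with sqrt (∙-nonneg v)
  ... | α , _ , αα≈v with inverse α (λ α≈0 → ne (trans (sym αα≈v) (trans (*-congʳ α≈0) (zeroˡ α))))
  ... | β , αβ≈1 = α , β , αβ≈1 , (begin
    (β ⊛ v) ∙ (β ⊛ v)      ≈⟨ trans (∙-⊛ʳ (β ⊛ v) β v) (*-congˡ (∙-⊛ˡ β v v)) ⟩
    β * (β * (v ∙ v))      ≈⟨ *-congˡ (*-congˡ αα≈v) ⟨
    β * (β * (α * α))      ≈⟨ solve 2 (λ a b → b :* (b :* (a :* a)) := a :* b :* (a :* b)) refl α β ⟩
    (α * β) * (α * β)      ≈⟨ trans (*-cong αβ≈1 αβ≈1) (*-identityˡ 1#) ⟩
    1#                     ∎) where open ≈-R

  Orthonormal : ∀ {n k} → (Fin k → Vector Carrier n) → Set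
  Orthonormal u = ∀ i j → u i ∙ u j ≈ δ i j

  orthonormal-∙-combination : ∀ {n k} {u : Fin k → Vector Carrier n} → Orthonormal u →
                              ∀ c j → u j ∙ combination c u ≈ c j
  orthonormal-∙-combination {u = u} orth c j =
    trans (∙-combination (u j) c u) (trans (sum-cong-≋ (λ i → *-congˡ {c i} (trans (∙-comm (u j) (u i)) (orth i j)))) (∑-δʳ j c))

  -- For the projection p of v onto the span, v∙p and p∙p both equal the left side, so the squared
  -- norm of v - p is the difference of the two sides.
  bessel : ∀ {n k} {u : Fin k → Vector Carrier n} → Orthonormal u → ∀ v →
           ∑[ i < k ] ((u i ∙ v) * (u i ∙ v)) ≤ v ∙ v
  bessel {k = k} {u} orth v = 0≤-⇒≤ (≤-trans (∙-nonneg (1# ⊛ v +ⱽ (- 1#) ⊛ p)) (≤-reflexive (begin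
    (1# ⊛ v +ⱽ (- 1#) ⊛ p) ∙ (1# ⊛ v +ⱽ (- 1#) ⊛ p)                             ≈⟨ norm-+ 1# (- 1#) v p ⟩
    1# * 1# * (v ∙ v) + (1# + 1#) * - 1# * (v ∙ p) + - 1# * - 1# * (p ∙ p)      ≈⟨ +-cong (+-congˡ (*-congˡ v∙p)) (*-congˡ p∙p) ⟩
    1# * 1# * (v ∙ v) + (1# + 1#) * - 1# * s + - 1# * - 1# * s
      ≈⟨ solve 2 (λ a s → con (+ 1) :* con (+ 1) :* a :+ (con (+ 1) :+ con (+ 1)) :* :- con (+ 1) :* s :+ :- con (+ 1) :* :- con (+ 1) :* s := a :- s) refl _ _ ⟩
    v ∙ v - s ∎)))
    where
    open ≈-R
    p = combination (λ i → u i ∙ v) u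
    s = ∑[ i < k ] ((u i ∙ v) * (u i ∙ v))
    v∙p : v ∙ p ≈ s
    v∙p = trans (∙-combination v _ u) (sum-cong-≋ (λ i → *-congˡ {u i ∙ v} (∙-comm v (u i))))
    p∙p : p ∙ p ≈ s
    p∙p = trans (combination-∙ _ u p) (sum-cong-≋ (λ i → *-congˡ {u i ∙ v} (orthonormal-∙-combination {u = u} orth _ i)))

  -- For P = Σ uᵢuᵢᵀ, the squared Frobenius norm of 1 − P is n − 2n + n = 0.
  orthonormal-complete : ∀ {n} {u : Fin n → Vector Carrier n} → Orthonormal u →
                         ∀ a b → ∑[ i < n ] (u i a * u i b) ≈ δ a b
  orthonormal-complete {n} {u} orth a b = begin
    P a b                      ≈⟨ solve 2 (λ d p → p := d :- (d :- p)) refl (δ a b) (P a b) ⟩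
    δ a b - (δ a b - P a b)    ≈⟨ +-congˡ (-‿cong (∙≈0⇒≈0 (λ b → δ a b - P a b) (∑≈0⇒≈0 (λ a → ∙-nonneg (λ b → δ a b - P a b)) frobenius a) b)) ⟩
    δ a b - 0#                 ≈⟨ solve 1 (λ d → d :- con (+ 0) := d) refl (δ a b) ⟩
    δ a b                      ∎
    where
    open ≈-R
    P : Matrix n
    P a b = ∑[ i < n ] (u i a * u i b)
    N = ∑[ a < n ] 1#
    trace : ∑[ a < n ] P a a ≈ N
    trace = trans (∑-comm (λ a i → u i a * u i a)) (sum-cong-≋ (λ i → trans (orth i i) (δ-refl i)))
    idem : ∀ a → ∑[ b < n ] (P a b * P a b) ≈ P a a
    idem a = begin
      P a ∙ P a                                  ≈⟨ ∙-combination (P a) (λ i → u i a) u ⟩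
      ∑[ i < n ] (u i a * (P a ∙ u i))           ≈⟨ sum-cong-≋ (λ i → *-congˡ {u i a} (trans (∙-comm (P a) (u i)) (orthonormal-∙-combination {u = u} orth (λ i → u i a) i))) ⟩
      P a a                                      ∎
    row : ∀ a → ∑[ b < n ] ((δ a b - P a b) * (δ a b - P a b)) ≈ 1# - P a a
    row a = begin
      ∑[ b < n ] ((δ a b - P a b) * (δ a b - P a b))
        ≈⟨ sum-cong-≋ (λ b → solve 2 (λ d p → (d :- p) :* (d :- p) := d :* (d :- (p :+ p)) :+ p :* p) refl (δ a b) (P a b)) ⟩
      ∑[ b < n ] (δ a b * (δ a b - (P a b + P a b)) + P a b * P a b)
        ≈⟨ ∑-distrib-+ (λ b → δ a b * (δ a b - (P a b + P a b))) (λ b → P a b * P a b) ⟩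
      ∑[ b < n ] (δ a b * (δ a b - (P a b + P a b))) + ∑[ b < n ] (P a b * P a b)
        ≈⟨ +-cong (∑-δˡ a (λ b → δ a b - (P a b + P a b))) (idem a) ⟩
      δ a a - (P a a + P a a) + P a a
        ≈⟨ solve 2 (λ d p → d :- (p :+ p) :+ p := d :- p) refl (δ a a) (P a a) ⟩
      δ a a - P a a
        ≈⟨ +-congʳ (δ-refl a) ⟩
      1# - P a a ∎
    frobenius : ∑[ a < n ] ∑[ b < n ] ((δ a b - P a b) * (δ a b - P a b)) ≈ 0#
    frobenius = begin
      ∑[ a < n ] ∑[ b < n ] ((δ a b - P a b) * (δ a b - P a b)) ≈⟨ sum-cong-≋ row ⟩
      ∑[ a < n ] (1# - P a a)                                   ≈⟨ ∑-distrib-- (λ _ → 1#) (λ a → P a a) ⟩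
      N - ∑[ a < n ] P a a                                      ≈⟨ +-congˡ (-‿cong trace) ⟩
      N - N                                                     ≈⟨ solve 1 (λ x → x :- x := con (+ 0)) refl N ⟩
      0#                                                        ∎

  orthonormal-expansion : ∀ {n} {u : Fin n → Vector Carrier n} → Orthonormal u →
                          ∀ v → v ≈ⱽ combination (λ i → u i ∙ v) u
  orthonormal-expansion {n} {u} orth v a = sym (begin
    ∑[ i < n ] ((u i ∙ v) * u i a)                   ≈⟨ sum-cong-≋ (λ i → trans (*-comm (u i ∙ v) (u i a)) (*-congˡ (∙-comm (u i) v))) ⟩
    ∑[ i < n ] (u i a * (v ∙ u i))                   ≈⟨ ∙-combination v (λ i → u i a) u ⟨
    v ∙ (λ b → ∑[ i < n ] (u i a * u i b))           ≈⟨ ∙-congˡ v (λ b → trans (orthonormal-complete {u = u} orth a b) (δ-comm a b)) ⟩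
    ∑[ b < n ] (v b * δ b a)                         ≈⟨ ∑-δʳ a v ⟩
    v a                                              ∎) where open ≈-R

  parseval : ∀ {n} {u : Fin n → Vector Carrier n} → Orthonormal u →
             ∀ v w → v ∙ w ≈ ∑[ i < n ] ((u i ∙ v) * (u i ∙ w))
  parseval {u = u} orth v w = trans (∙-cong {v = w} (orthonormal-expansion {u = u} orth v) (λ _ → refl))
                                    (combination-∙ (λ i → u i ∙ v) u w)

  -- Least eigenvalues

  -- With a zero diagonal entry the form at t eᵢ + eⱼ is linear in t, namely 2tMᵢⱼ + Mⱼⱼ. If Mᵢⱼ ≠
  -- 0, then t = -(1 + Mⱼⱼ)/Mᵢⱼ makes it -2 - Mⱼⱼ < 0.
  psd-zero-row : ∀ {n} {M : Matrix n} → IsSymmetric M → PositiveSemidefinite M →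
                 ∀ i → M i i ≈ 0# → ∀ j → M i j ≈ 0#
  psd-zero-row {n} {M} M-sym psd i Mii≈0 j with M i j ≟ 0#
  ... | yes eq = eq
  ... | no  ne = contradiction (≤-resp refl negative (psd (t ⊛ δ i +ⱽ δ j))) 0≰-2-c
    where
    open ≈-R
    c = M j j
    c≥0 : 0# ≤ c
    c≥0 = ≤-resp refl (δ-quadratic M j) (psd (δ j))
    inv = inverse (M i j) ne
    y = proj₁ inv
    t = - ((1# + c) * y)
    0≰-2-c : ¬ (0# ≤ - (1# + (1# + c)))
    0≰-2-c p = 0<1+ (+-nonneg 0≤1 c≥0)
      (≤-resp (+-identityʳ _) (solve 1 (λ x → x :+ :- x := con (+ 0)) refl (1# + (1# + c))) (+-monoʳ-≤ (1# + (1# + c)) p))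
    negative : (t ⊛ δ i +ⱽ δ j) ∙ (M *ⱽ (t ⊛ δ i +ⱽ δ j)) ≈ - (1# + (1# + c))
    negative = begin
      (t ⊛ δ i +ⱽ δ j) ∙ (M *ⱽ (t ⊛ δ i +ⱽ δ j))
        ≈⟨ quadratic-+ {A = M} M-sym t (δ i) (δ j) ⟩
      t * t * (δ i ∙ (M *ⱽ δ i)) + (t + t) * (δ i ∙ (M *ⱽ δ j)) + δ j ∙ (M *ⱽ δ j)
        ≈⟨ +-cong (+-cong (*-congˡ (trans (δ-quadratic M i) Mii≈0)) (*-congˡ (trans (δ-∙ i _) (*ⱽ-δ M j i)))) (δ-quadratic M j) ⟩
      t * t * 0# + (t + t) * M i j + c
        ≈⟨ solve 3 (λ c y m → let t = :- ((con (+ 1) :+ c) :* y) in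
             t :* t :* con (+ 0) :+ (t :+ t) :* m :+ c := :- (con (+ 2) :* (con (+ 1) :+ c) :* (m :* y)) :+ c) refl c y (M i j) ⟩
      - ((1# + 1#) * (1# + c) * (M i j * y)) + c
        ≈⟨ +-congʳ (-‿cong (*-congˡ (proj₂ inv))) ⟩
      - ((1# + 1#) * (1# + c) * 1#) + c
        ≈⟨ solve 1 (λ c → :- (con (+ 2) :* (con (+ 1) :+ c) :* con (+ 1)) :+ c := :- (con (+ 1) :+ (con (+ 1) :+ c))) refl c ⟩
      - (1# + (1# + c)) ∎

  NullVector : ∀ {n} → Matrix n → Set
  NullVector M = ∃[ v ] (¬ (v ∙ v ≈ 0#) × (∀ i → (M *ⱽ v) i ≈ 0#))

  -- A uniform positive lower bound 1/K on the Rayleigh quotient. Keeping `K` on the right spares a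
  -- division and admits K = 0 for the empty matrix.
  Coercive : ∀ {n} → Matrix n → Set
  Coercive M = ∃[ K ] (0# ≤ K × ∀ v → v ∙ v ≤ K * (v ∙ (M *ⱽ v)))

  -- With b = aβ, the quadratic form of [a bᵀ; b C] at (x, y) is
  -- a(x + β∙y)² + yᵀSy for the Schur complement S = C − aββᵀ.
  module Schur {n} {M : Matrix (suc n)} (M-sym : IsSymmetric M)
               (β : Vector Carrier n) (column : ∀ i → M (suc i) zero ≈ M zero zero * β i) where
    open ≈-R
    a = M zero zero

    S : Matrix n
    S i j = M (suc i) (suc j) - a * β i * β j

    S-sym : IsSymmetric S
    S-sym i j = +-cong (M-sym (suc i) (suc j)) (-‿cong (solve 3 (λ a b c → a :* b :* c := a :* c :* b) refl a (β i) (β j)))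

    _⌢_ : Carrier → Vector Carrier n → Vector Carrier (suc n)
    (x ⌢ y) zero    = x
    (x ⌢ y) (suc i) = y i

    S*ⱽ : ∀ y i → (S *ⱽ y) i ≈ ((λ i j → M (suc i) (suc j)) *ⱽ y) i - a * β i * (β ∙ y)
    S*ⱽ y i = begin
      ∑[ j < n ] ((M (suc i) (suc j) - a * β i * β j) * y j)
        ≈⟨ sum-cong-≋ (λ j → solve 4 (λ m c b y → (m :- c :* b) :* y := m :* y :- c :* (b :* y)) refl (M (suc i) (suc j)) (a * β i) (β j) (y j)) ⟩
      ∑[ j < n ] (M (suc i) (suc j) * y j - a * β i * (β j * y j))
        ≈⟨ ∑-distrib-- (λ j → M (suc i) (suc j) * y j) (λ j → a * β i * (β j * y j)) ⟩
      ∑[ j < n ] (M (suc i) (suc j) * y j) - ∑[ j < n ] (a * β i * (β j * y j))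
        ≈⟨ +-congˡ (-‿cong (*-distribˡ-sum (a * β i) (λ j → β j * y j))) ⟨
      ∑[ j < n ] (M (suc i) (suc j) * y j) - a * β i * (β ∙ y) ∎

    M*ⱽ-zero : ∀ x y → (M *ⱽ (x ⌢ y)) zero ≈ a * (x + β ∙ y)
    M*ⱽ-zero x y = begin
      a * x + ∑[ j < n ] (M zero (suc j) * y j)
        ≈⟨ +-congˡ (sum-cong-≋ (λ j → trans (*-congʳ (trans (M-sym zero (suc j)) (column j))) (*-assoc a (β j) (y j)))) ⟩
      a * x + ∑[ j < n ] (a * (β j * y j))     ≈⟨ +-congˡ (*-distribˡ-sum a (λ j → β j * y j)) ⟨
      a * x + a * (β ∙ y)                      ≈⟨ distribˡ a x (β ∙ y) ⟨
      a * (x + β ∙ y)                          ∎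

    M*ⱽ-suc : ∀ x y i → (M *ⱽ (x ⌢ y)) (suc i) ≈ a * (x + β ∙ y) * β i + (S *ⱽ y) i
    M*ⱽ-suc x y i = begin
      M (suc i) zero * x + Cy                              ≈⟨ +-congʳ (*-congʳ (column i)) ⟩
      a * β i * x + Cy
        ≈⟨ solve 5 (λ a b x p c → a :* b :* x :+ c := a :* (x :+ p) :* b :+ (c :- a :* b :* p)) refl a (β i) x (β ∙ y) Cy ⟩
      a * (x + β ∙ y) * β i + (Cy - a * β i * (β ∙ y))     ≈⟨ +-congˡ (S*ⱽ y i) ⟨
      a * (x + β ∙ y) * β i + (S *ⱽ y) i                   ∎
      where Cy = ∑[ j < n ] (M (suc i) (suc j) * y j)

    quadratic : ∀ x y → (x ⌢ y) ∙ (M *ⱽ (x ⌢ y)) ≈ a * ((x + β ∙ y) * (x + β ∙ y)) + y ∙ (S *ⱽ y)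
    quadratic x y = begin
      x * (M *ⱽ (x ⌢ y)) zero + y ∙ (λ i → (M *ⱽ (x ⌢ y)) (suc i))
        ≈⟨ +-cong (*-congˡ (M*ⱽ-zero x y)) (∙-congˡ y (M*ⱽ-suc x y)) ⟩
      x * c + y ∙ (c ⊛ β +ⱽ S *ⱽ y)
        ≈⟨ +-congˡ (trans (∙-+ʳ y (c ⊛ β) (S *ⱽ y)) (+-congʳ (trans (∙-⊛ʳ y c β) (*-congˡ (∙-comm y β))))) ⟩
      x * c + (c * (β ∙ y) + y ∙ (S *ⱽ y))
        ≈⟨ solve 4 (λ a x p q → x :* (a :* (x :+ p)) :+ (a :* (x :+ p) :* p :+ q) := a :* ((x :+ p) :* (x :+ p)) :+ q) refl a x (β ∙ y) (y ∙ (S *ⱽ y)) ⟩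
      a * ((x + β ∙ y) * (x + β ∙ y)) + y ∙ (S *ⱽ y) ∎
      where c = a * (x + β ∙ y)

    a*[-p+p]≈0 : ∀ p → a * (- p + p) ≈ 0#
    a*[-p+p]≈0 = solve 2 (λ a p → a :* (:- p :+ p) := con (+ 0)) refl a

    -- The first coordinate -β∙y kills the square in `quadratic` and leaves the form of `S`. The
    -- same lift of y carries null vectors of `S` to null vectors of `M`.
    S-psd : PositiveSemidefinite M → PositiveSemidefinite S
    S-psd psd y = ≤-trans (psd ((- (β ∙ y)) ⌢ y)) (≤-reflexive (trans (quadratic _ y)
      (solve 3 (λ a p q → a :* ((:- p :+ p) :* (:- p :+ p)) :+ q := q) refl a (β ∙ y) _)))

    nullVector : NullVector S → NullVector M
    nullVector (y , y≉0 , Sy≈0) = v , v≉0 , Mv≈0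
      where
      v = (- (β ∙ y)) ⌢ y
      v≉0 : ¬ (v ∙ v ≈ 0#)
      v≉0 eq = y≉0 (∑-zero (λ i → trans (*-congˡ (∙≈0⇒≈0 v eq (suc i))) (zeroʳ _)))
      Mv≈0 : ∀ i → (M *ⱽ v) i ≈ 0#
      Mv≈0 zero    = trans (M*ⱽ-zero _ y) (a*[-p+p]≈0 (β ∙ y))
      Mv≈0 (suc i) = trans (M*ⱽ-suc _ y i) (trans (+-cong (trans (*-congʳ (a*[-p+p]≈0 (β ∙ y))) (zeroˡ _)) (Sy≈0 i)) (+-identityʳ 0#))

    -- With p = β∙y, x² ≤ 2(x + p)² + 2p² and p² ≤ BY by Cauchy-Schwarz, so x² + Y ≤ 2(x + p)² + LY.
    -- Here (x + p)² = dA and Y ≤ KQ, which gives K′ = 2d + LK.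
    coercive : PositiveSemidefinite M → 0# < a → Coercive S → Coercive M
    coercive psd 0<a (K , 0≤K , bound) = K′ , 0≤K′ , bound′
      where
      inv = inverse-pos 0<a
      d = proj₁ inv
      0≤d = proj₁ (proj₂ inv)
      ad≈1 = proj₂ (proj₂ inv)
      B = β ∙ β
      L = 1# + (B + B)
      0≤L : 0# ≤ L
      0≤L = +-nonneg 0≤1 (+-nonneg (∙-nonneg β) (∙-nonneg β))
      K′ = (d + d) + L * K
      0≤K′ : 0# ≤ K′
      0≤K′ = +-nonneg (+-nonneg 0≤d 0≤d) (*-nonneg 0≤L 0≤K)
      bound′ : ∀ v → v ∙ v ≤ K′ * (v ∙ (M *ⱽ v))
      bound′ v = ≤-trans step₁ (≤-trans step₂ step₃)
        where
        x = v zero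
        y : Vector Carrier n
        y i = v (suc i)
        p = β ∙ y
        A = a * ((x + p) * (x + p))
        Q = y ∙ (S *ⱽ y)
        Y = y ∙ y
        head⌢tail : v ≈ⱽ x ⌢ y
        head⌢tail zero    = refl
        head⌢tail (suc _) = refl
        form : v ∙ (M *ⱽ v) ≈ A + Q
        form = trans (∙-congˡ v (*ⱽ-cong M {v} {x ⌢ y} head⌢tail)) (quadratic x y)
        dA : d * A ≈ (x + p) * (x + p)
        dA = trans (solve 3 (λ d a z → d :* (a :* z) := a :* d :* z) refl d a _) (trans (*-congʳ ad≈1) (*-identityˡ _))
        0≤A : 0# ≤ A
        0≤A = *-nonneg (<⇒≤ 0<a) (sq-nonneg (x + p))
        step₁ : x * x + Y ≤ (d * A + d * A) + L * Y
        step₁ = ≤+nonneg (+-nonneg (sq-nonneg (x + (p + p))) (+-nonneg (≤⇒0≤- (cauchy-schwarz β y)) (≤⇒0≤- (cauchy-schwarz β y)))) (begin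
          (d * A + d * A) + L * Y  ≈⟨ +-congʳ (+-cong dA dA) ⟩
          ((x + p) * (x + p) + (x + p) * (x + p)) + L * Y
            ≈⟨ solve 4 (λ x p b y → ((x :+ p) :* (x :+ p) :+ (x :+ p) :* (x :+ p)) :+ (con (+ 1) :+ (b :+ b)) :* y
                 := (x :* x :+ y) :+ ((x :+ (p :+ p)) :* (x :+ (p :+ p)) :+ ((b :* y :- p :* p) :+ (b :* y :- p :* p)))) refl x p B Y ⟩
          (x * x + Y) + ((x + (p + p)) * (x + (p + p)) + ((B * Y - p * p) + (B * Y - p * p))) ∎)
        step₂ : (d * A + d * A) + L * Y ≤ (d * A + d * A) + L * (K * Q)
        step₂ = +-monoʳ-≤ _ (*-monoˡ 0≤L (bound y))
        step₃ : (d * A + d * A) + L * (K * Q) ≤ K′ * (v ∙ (M *ⱽ v))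
        step₃ = ≤+nonneg (+-nonneg (*-nonneg (+-nonneg 0≤d 0≤d) (S-psd psd y)) (*-nonneg (*-nonneg 0≤L 0≤K) 0≤A)) (trans (*-congˡ form)
          (solve 5 (λ d l k a q → ((d :+ d) :+ l :* k) :* (a :+ q) := ((d :* a :+ d :* a) :+ l :* (k :* q)) :+ ((d :+ d) :* q :+ l :* k :* a))
            refl d L K A Q))

  schur-dichotomy : ∀ {n} {M : Matrix (suc n)} → IsSymmetric M → PositiveSemidefinite M → ¬ (M zero zero ≈ 0#) →
                    (∀ (S : Matrix n) → IsSymmetric S → PositiveSemidefinite S → NullVector S ⊎ Coercive S) →
                    NullVector M ⊎ Coercive M
  schur-dichotomy {n} {M} M-sym psd a≉0 ih = Sum.map nullVector (coercive psd (≤∧≉⇒< 0≤a a≉0)) (ih S S-sym (S-psd psd))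
    where
    inv = inverse (M zero zero) a≉0
    β : Vector Carrier n
    β i = proj₁ inv * M (suc i) zero
    column : ∀ i → M (suc i) zero ≈ M zero zero * β i
    column i = sym (trans (sym (*-assoc (M zero zero) (proj₁ inv) (M (suc i) zero)))
                          (trans (*-congʳ (proj₂ inv)) (*-identityˡ _)))
    open Schur {n} {M} M-sym β column
    0≤a : 0# ≤ M zero zero
    0≤a = ≤-resp refl (δ-quadratic M zero) (psd (δ zero))

  δ-null : ∀ {n} {M : Matrix (suc n)} → IsSymmetric M → PositiveSemidefinite M → M zero zero ≈ 0# → NullVector M
  δ-null {n} {M} M-sym psd a≈0 = δ zero ,
    (λ eq → 0≉1 (trans (sym eq) (δ-norm {suc n} zero))) ,
    λ i → trans (*ⱽ-δ M zero i) (trans (M-sym i zero) (psd-zero-row {M = M} M-sym psd zero a≈0 i))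

  -- The substitute for compactness is Gaussian elimination. A zero pivot forces a zero first
  -- column, so e₀ is a null vector; a nonzero pivot is positive, and either alternative lifts from
  -- the Schur complement.
  psd-dichotomy : ∀ {n} (M : Matrix n) → IsSymmetric M → PositiveSemidefinite M →
                  NullVector M ⊎ Coercive M
  psd-dichotomy {zero}  M _ _ = inj₂ (0# , ≤-refl , λ v → ≤-reflexive (sym (zeroˡ 0#)))
  psd-dichotomy {suc n} M M-sym psd with M zero zero ≟ 0#
  ... | yes a≈0 = inj₁ (δ-null {M = M} M-sym psd a≈0)
  ... | no  a≉0 = schur-dichotomy {M = M} M-sym psd a≉0 psd-dichotomy

  -- A bound on the Rayleigh quotient with the denominator cleared, so that w = 0 needs no
  -- exclusion.
  LowerBound : ∀ {n} → Matrix n → Carrier → Set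
  LowerBound B μ = ∀ w → μ * (w ∙ w) ≤ w ∙ (B *ⱽ w)

  square-trinomial-nonneg : ∀ a b → 0# ≤ a * a + a * b + b * b
  square-trinomial-nonneg a b = half-nonneg (≤-trans
    (+-nonneg (+-nonneg (sq-nonneg a) (sq-nonneg b)) (sq-nonneg (a + b)))
    (≤-reflexive (solve 2 (λ a b → a :* a :+ b :* b :+ (a :+ b) :* (a :+ b)
      := (a :* a :+ a :* b :+ b :* b) :+ (a :* a :+ a :* b :+ b :* b)) refl a b)))

  -- A crude constant, K = Σ (1 + Bᵢⱼ²), that avoids absolute values: each wᵢBᵢⱼwⱼ is at least
  -- -(Bᵢⱼ²wᵢ² + wⱼ²), and wᵢ² and wⱼ² are at most w∙w.
  lowerBound-exists : ∀ {n} (B : Matrix n) → ∃ (LowerBound B)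
  lowerBound-exists {n} B = - K , λ w → 0≤-⇒≤ (≤-trans (∑-nonneg (λ i → ∑-nonneg (λ j → term w i j))) (≤-reflexive (begin
      ∑[ i < n ] ∑[ j < n ] ((1# + B i j * B i j) * (w ∙ w) + w i * (B i j * w j))
        ≈⟨ sum-cong-≋ (λ i → trans (∑-distrib-+ (λ j → (1# + B i j * B i j) * (w ∙ w)) (λ j → w i * (B i j * w j)))
             (+-cong (sym (*-distribʳ-sum (w ∙ w) (λ j → 1# + B i j * B i j))) (sym (*-distribˡ-sum (w i) (λ j → B i j * w j))))) ⟩
      ∑[ i < n ] (k i * (w ∙ w) + w i * (B *ⱽ w) i)
        ≈⟨ ∑-distrib-+ (λ i → k i * (w ∙ w)) (λ i → w i * (B *ⱽ w) i) ⟩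
      ∑[ i < n ] (k i * (w ∙ w)) + w ∙ (B *ⱽ w)
        ≈⟨ +-congʳ (*-distribʳ-sum (w ∙ w) k) ⟨
      K * (w ∙ w) + w ∙ (B *ⱽ w)
        ≈⟨ solve 3 (λ k n q → k :* n :+ q := q :- :- k :* n) refl K (w ∙ w) (w ∙ (B *ⱽ w)) ⟩
      w ∙ (B *ⱽ w) - - K * (w ∙ w) ∎)))
    where
    open ≈-R
    k : Vector Carrier n
    k i = ∑[ j < n ] (1# + B i j * B i j)
    K = ∑[ i < n ] k i
    term : ∀ w i j → 0# ≤ (1# + B i j * B i j) * (w ∙ w) + w i * (B i j * w j)
    term w i j = ≤-trans (+-nonneg (square-trinomial-nonneg (b * x) y) (+-nonneg (*-nonneg (sq-nonneg b) (≤⇒0≤- (sq≤∙ w i))) (≤⇒0≤- (sq≤∙ w j))))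
      (≤-reflexive (solve 4 (λ b x y s → (b :* x :* (b :* x) :+ b :* x :* y :+ y :* y) :+ (b :* b :* (s :- x :* x) :+ (s :- y :* y))
        := (con (+ 1) :+ b :* b) :* s :+ x :* (b :* y)) refl b x y (w ∙ w)))
      where
      b = B i j
      x = w i
      y = w j

  shift : ∀ {n} → Matrix n → Carrier → Matrix n
  shift B s i j = B i j - s * δ i j

  shift-sym : ∀ {n} (B : Matrix n) s → IsSymmetric B → IsSymmetric (shift B s)
  shift-sym B s B-sym i j = +-cong (B-sym i j) (-‿cong (*-congˡ (δ-comm i j)))

  shift-*ⱽ : ∀ {n} (B : Matrix n) s w i → (shift B s *ⱽ w) i ≈ (B *ⱽ w) i - s * w i
  shift-*ⱽ {n} B s w i = begin
    ∑[ j < n ] ((B i j - s * δ i j) * w j)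
      ≈⟨ sum-cong-≋ (λ j → solve 4 (λ b s d w → (b :- s :* d) :* w := b :* w :- s :* (d :* w)) refl (B i j) s (δ i j) (w j)) ⟩
    ∑[ j < n ] (B i j * w j - s * (δ i j * w j))
      ≈⟨ ∑-distrib-- (λ j → B i j * w j) (λ j → s * (δ i j * w j)) ⟩
    (B *ⱽ w) i - ∑[ j < n ] (s * (δ i j * w j))
      ≈⟨ +-congˡ (-‿cong (trans (sym (*-distribˡ-sum s (λ j → δ i j * w j))) (*-congˡ (∑-δˡ i w)))) ⟩
    (B *ⱽ w) i - s * w i ∎ where open ≈-R

  shift-quadratic : ∀ {n} (B : Matrix n) s w → w ∙ (shift B s *ⱽ w) ≈ w ∙ (B *ⱽ w) - s * (w ∙ w)
  shift-quadratic B s w = begin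
    w ∙ (shift B s *ⱽ w)                      ≈⟨ ∙-congˡ w (λ i → trans (shift-*ⱽ B s w i) (solve 3 (λ b s w → b :- s :* w := b :+ (:- s) :* w) refl ((B *ⱽ w) i) s (w i))) ⟩
    w ∙ (B *ⱽ w +ⱽ (- s) ⊛ w)                 ≈⟨ ∙-+ʳ w (B *ⱽ w) ((- s) ⊛ w) ⟩
    w ∙ (B *ⱽ w) + w ∙ ((- s) ⊛ w)            ≈⟨ +-congˡ (∙-⊛ʳ w (- s) w) ⟩
    w ∙ (B *ⱽ w) + - s * (w ∙ w)              ≈⟨ solve 3 (λ b s n → b :+ :- s :* n := b :- s :* n) refl (w ∙ (B *ⱽ w)) s (w ∙ w) ⟩
    w ∙ (B *ⱽ w) - s * (w ∙ w)                ∎ where open ≈-R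

  shift-psd : ∀ {n} (B : Matrix n) s → LowerBound B s → PositiveSemidefinite (shift B s)
  shift-psd B s lb w = ≤-trans (≤⇒0≤- (lb w)) (≤-reflexive (sym (shift-quadratic B s w)))

  -- The gain is 1/(1 + K); the added 1 keeps the denominator positive when K = 0.
  shift-coercive : ∀ {n} (B : Matrix n) s → LowerBound B s → Coercive (shift B s) →
                   ∃[ ε ] (0# < ε × LowerBound B (s + ε))
  shift-coercive B s lb (K , 0≤K , bound) with inverse-pos (0<1+ 0≤K)
  ... | y , 0≤y , Ky≈1 = y , 0<y , larger
    where
    open ≈-R
    0<y : 0# < y
    0<y p = 0<1 (≤-resp Ky≈1 (zeroʳ (1# + K)) (*-monoˡ (+-nonneg 0≤1 0≤K) p))
    larger : LowerBound B (s + y)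
    larger w = ≤-resp (sym (distribʳ n s y))
        (trans (+-congˡ (shift-quadratic B s w)) (solve 2 (λ b c → c :+ (b :- c) := b) refl b (s * n)))
        (+-monoʳ-≤ (s * n) yn≤m)
      where
      b = w ∙ (B *ⱽ w)
      n = w ∙ w
      m = w ∙ (shift B s *ⱽ w)
      n≤ : n ≤ (1# + K) * m
      n≤ = ≤-trans (bound w) (≤+nonneg (shift-psd B s lb w) (solve 2 (λ k m → (con (+ 1) :+ k) :* m := k :* m :+ m) refl K m))
      yn≤m : y * n ≤ m
      yn≤m = ≤-trans (*-monoˡ 0≤y n≤) (≤-reflexive (trans
        (solve 3 (λ y k m → y :* (k :* m) := k :* y :* m) refl y (1# + K) m)
        (trans (*-congʳ Ky≈1) (*-identityˡ m))))

  unit-eigenvector : ∀ {n} (B : Matrix n) s v → ¬ (v ∙ v ≈ 0#) → Eigenspace B s v →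
                     ∃[ w ] (w ∙ w ≈ 1# × Eigenspace B s w)
  unit-eigenvector B s v v≉0 eigen = scale (normalise v v≉0)
    where
    open ≈-R
    scale : (Σ[ α ∈ Carrier ] Σ[ β ∈ Carrier ] (α * β ≈ 1# × (β ⊛ v) ∙ (β ⊛ v) ≈ 1#)) →
            ∃[ w ] (w ∙ w ≈ 1# × Eigenspace B s w)
    scale (_ , c , _ , unit) = c ⊛ v , unit , λ i → begin
      (B *ⱽ (c ⊛ v)) i   ≈⟨ *ⱽ-⊛ B c v i ⟩
      c * (B *ⱽ v) i     ≈⟨ *-congˡ (eigen i) ⟩
      c * (s * v i)      ≈⟨ solve 3 (λ c s v → c :* (s :* v) := s :* (c :* v)) refl c s (v i) ⟩
      s * (c * v i)      ∎

  shift-null : ∀ {n} (B : Matrix n) s v → (∀ i → (shift B s *ⱽ v) i ≈ 0#) → Eigenspace B s v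
  shift-null B s v Mv≈0 i = begin
    (B *ⱽ v) i                         ≈⟨ solve 2 (λ b c → b := b :- c :+ c) refl ((B *ⱽ v) i) (s * v i) ⟩
    (B *ⱽ v) i - s * v i + s * v i     ≈⟨ +-congʳ (trans (sym (shift-*ⱽ B s v i)) (Mv≈0 i)) ⟩
    0# + s * v i                       ≈⟨ +-identityˡ (s * v i) ⟩
    s * v i                            ∎ where open ≈-R

  lowerBound≤diagonal : ∀ {n} (B : Matrix n) o μ → LowerBound B μ → μ ≤ B o o
  lowerBound≤diagonal B o μ lb = ≤-resp (trans (*-congˡ (δ-norm o)) (*-identityʳ μ)) (δ-quadratic B o) (lb (δ o))

  -- For a fixed w ≠ 0 the Rayleigh quotient of w is an upper bound of all lower bounds, hence at
  -- least their supremum.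
  supremum-lowerBound : ∀ {n} (B : Matrix n) s → (∀ u → (∀ μ → LowerBound B μ → μ ≤ u) → s ≤ u) → LowerBound B s
  supremum-lowerBound B s least w = by-cases (w ∙ w ≟ 0#)
    where
    q = w ∙ (B *ⱽ w)
    by-inverse : ∃[ y ] (0# ≤ y × (w ∙ w) * y ≈ 1#) → s * (w ∙ w) ≤ q
    by-inverse (y , 0≤y , wy≈1) = ≤-trans (*-monoʳ (∙-nonneg w) (least (y * q) below)) (≤-reflexive (cancelʳ q))
      where
      cancel : ∀ z → (w ∙ w) * y * z ≈ z
      cancel z = trans (*-congʳ wy≈1) (*-identityˡ z)
      cancelʳ : ∀ z → y * z * (w ∙ w) ≈ z
      cancelʳ z = trans (solve 3 (λ y q n → y :* q :* n := n :* y :* q) refl y z (w ∙ w)) (cancel z)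
      below : ∀ μ → LowerBound B μ → μ ≤ y * q
      below μ lb = ≤-resp (trans (solve 3 (λ y m n → y :* (m :* n) := n :* y :* m) refl y μ (w ∙ w)) (cancel μ)) refl (*-monoˡ 0≤y (lb w))
    by-cases : Dec (w ∙ w ≈ 0#) → s * (w ∙ w) ≤ q
    by-cases (yes eq) = ≤-reflexive (trans (trans (*-congˡ eq) (zeroʳ s))
                          (sym (∑-zero (λ i → trans (*-congʳ (∙≈0⇒≈0 w eq i)) (zeroˡ ((B *ⱽ w) i))))))
    by-cases (no ne)  = by-inverse (inverse-pos (≤∧≉⇒< (∙-nonneg w) ne))

  -- The index `o` excludes the empty matrix, for which every number is a lower bound; otherwise the
  -- diagonal entry at `o` caps them all.
  greatest-lowerBound : ∀ {n} (B : Matrix n) → Fin n → ∃[ s ] (LowerBound B s × (∀ μ → LowerBound B μ → μ ≤ s))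
  greatest-lowerBound B o = from-supremum (supremum (LowerBound B) (lowerBound-exists B) (B o o , lowerBound≤diagonal B o))
    where
    from-supremum : ∃[ s ] (UpperBound (LowerBound B) s × (∀ u → UpperBound (LowerBound B) u → s ≤ u)) →
                    ∃[ s ] (LowerBound B s × (∀ μ → LowerBound B μ → μ ≤ s))
    from-supremum (s , ub , least) = s , supremum-lowerBound B s least , ub

  -- Were B − s coercive for the greatest lower bound s of the quadratic form of B,
  -- then some s + ε would be a lower bound too.
  least-eigenvector : ∀ {n} (B : Matrix n) → Fin n → IsSymmetric B →
    ∃[ μ ] ∃[ v ] (v ∙ v ≈ 1# × Eigenspace B μ v × LowerBound B μ)
  least-eigenvector B o B-sym = from-bound (greatest-lowerBound B o)
    where
    from-bound : ∃[ s ] (LowerBound B s × (∀ μ → LowerBound B μ → μ ≤ s)) →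
                 ∃[ μ ] ∃[ v ] (v ∙ v ≈ 1# × Eigenspace B μ v × LowerBound B μ)
    from-bound (s , lb , greatest) = from-dichotomy (psd-dichotomy (shift B s) (shift-sym B s B-sym) (shift-psd B s lb))
      where
      s+ε≰s : ∀ {ε} → 0# < ε → ¬ (s + ε ≤ s)
      s+ε≰s {ε} 0<ε p = 0<ε (≤-resp (solve 2 (λ s y → :- s :+ (s :+ y) := y) refl s ε)
                                    (solve 1 (λ s → :- s :+ s := con (+ 0)) refl s) (+-monoʳ-≤ (- s) p))
      from-unit : ∃[ v ] (v ∙ v ≈ 1# × Eigenspace B s v) →
                  ∃[ μ ] ∃[ v ] (v ∙ v ≈ 1# × Eigenspace B μ v × LowerBound B μ)
      from-unit (v , unit , eigen) = s , v , unit , eigen , lb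
      not-coercive : ¬ (∃[ ε ] (0# < ε × LowerBound B (s + ε)))
      not-coercive (ε , 0<ε , lb′) = s+ε≰s 0<ε (greatest (s + ε) lb′)
      from-dichotomy : NullVector (shift B s) ⊎ Coercive (shift B s) →
                       ∃[ μ ] ∃[ v ] (v ∙ v ≈ 1# × Eigenspace B μ v × LowerBound B μ)
      from-dichotomy (inj₁ (v , v≉0 , null)) = from-unit (unit-eigenvector B s v v≉0 (shift-null B s v null))
      from-dichotomy (inj₂ coercive)         = contradiction (shift-coercive B s lb coercive) not-coercive

  -- Orthonormal eigenbases

  ·-nonneg : ∀ {x} → 0# ≤ x → ∀ n → 0# ≤ n · x
  ·-nonneg 0≤x zero    = ≤-refl
  ·-nonneg 0≤x (suc n) = +-nonneg 0≤x (·-nonneg 0≤x n)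

  ·-monoˡ-≤ : ∀ {x} → 0# ≤ x → ∀ {m n} → m ℕ.≤ n → m · x ≤ n · x
  ·-monoˡ-≤ 0≤x {n = n} ℕ.z≤n = ·-nonneg 0≤x n
  ·-monoˡ-≤ {x} 0≤x (ℕ.s≤s p) = +-monoʳ-≤ x (·-monoˡ-≤ 0≤x p)

  -- The matrix A + Σ cᵢuᵢuᵢᵀ. Each row of the update is a `combination` of the uᵢ, so its product
  -- with w involves w only through the uᵢ∙w.
  deflate : ∀ {n k} → Matrix n → Vector Carrier k → (Fin k → Vector Carrier n) → Matrix n
  deflate A c u a b = A a b + combination (λ i → c i * u i a) u b

  module Deflation {n k} (A : Matrix n) (c : Vector Carrier k) (u : Fin k → Vector Carrier n) where
    open ≈-R
    B = deflate A c u

    deflate-sym : IsSymmetric A → IsSymmetric B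
    deflate-sym A-sym a b = +-cong (A-sym a b) (sum-cong-≋ (λ i →
      solve 3 (λ c x y → c :* x :* y := c :* y :* x) refl (c i) (u i a) (u i b)))

    deflate-*ⱽ : ∀ w a → (B *ⱽ w) a ≈ (A *ⱽ w) a + ∑[ i < k ] (c i * u i a * (u i ∙ w))
    deflate-*ⱽ w a = begin
      (A a +ⱽ combination (λ i → c i * u i a) u) ∙ w            ≈⟨ ∙-+ˡ (A a) (combination (λ i → c i * u i a) u) w ⟩
      A a ∙ w + combination (λ i → c i * u i a) u ∙ w           ≈⟨ +-congˡ (combination-∙ (λ i → c i * u i a) u w) ⟩
      (A *ⱽ w) a + ∑[ i < k ] (c i * u i a * (u i ∙ w))         ∎

    deflate-⊥ : ∀ w → (∀ i → u i ∙ w ≈ 0#) → B *ⱽ w ≈ⱽ A *ⱽ w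
    deflate-⊥ w w⊥u a = begin
      (B *ⱽ w) a                                                ≈⟨ deflate-*ⱽ w a ⟩
      (A *ⱽ w) a + ∑[ i < k ] (c i * u i a * (u i ∙ w))         ≈⟨ +-congˡ (∑-zero (λ i → trans (*-congˡ {c i * u i a} (w⊥u i)) (zeroʳ (c i * u i a)))) ⟩
      (A *ⱽ w) a + 0#                                           ≈⟨ +-identityʳ ((A *ⱽ w) a) ⟩
      (A *ⱽ w) a                                                ∎

    deflate-eigen : Orthonormal u → ∀ {μ} j → Eigenspace A μ (u j) → Eigenspace B (μ + c j) (u j)
    deflate-eigen orth {μ} j eigen a = begin
      (B *ⱽ u j) a                                                ≈⟨ deflate-*ⱽ (u j) a ⟩
      (A *ⱽ u j) a + ∑[ i < k ] (c i * u i a * (u i ∙ u j))       ≈⟨ +-cong (eigen a) (sum-cong-≋ (λ i → *-congˡ {c i * u i a} (orth i j))) ⟩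
      μ * u j a + ∑[ i < k ] (c i * u i a * δ i j)                ≈⟨ +-congˡ (∑-δʳ j (λ i → c i * u i a)) ⟩
      μ * u j a + c j * u j a                                     ≈⟨ distribʳ (u j a) μ (c j) ⟨
      (μ + c j) * u j a                                           ∎

    deflate-trace : Orthonormal u → tr B ≈ tr A + ∑[ i < k ] c i
    deflate-trace orth = begin
      ∑[ a < n ] (A a a + ∑[ i < k ] (c i * u i a * u i a))       ≈⟨ ∑-distrib-+ (λ a → A a a) (λ a → ∑[ i < k ] (c i * u i a * u i a)) ⟩
      tr A + ∑[ a < n ] ∑[ i < k ] (c i * u i a * u i a)          ≈⟨ +-congˡ (∑-comm (λ a i → c i * u i a * u i a)) ⟩
      tr A + ∑[ i < k ] ∑[ a < n ] (c i * u i a * u i a)          ≈⟨ +-congˡ (sum-cong-≋ (λ i → trans (∙-⊛ˡ (c i) (u i) (u i))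
                                                                       (trans (*-congˡ (trans (orth i i) (δ-refl i))) (*-identityʳ (c i))))) ⟩
      tr A + ∑[ i < k ] c i                                       ∎

  trace-bound : ∀ {n} (B : Matrix n) μ → LowerBound B μ → n · μ ≤ tr B
  trace-bound {n} B μ lb = ≤-resp (sum-replicate n) refl (∑-mono-≤ (λ a → lowerBound≤diagonal B a μ lb))

  -- Families grow from the smallest eigenvalue upwards, and each new one goes to the front, so the
  -- list is always decreasing. `extremal` is the invariant behind this: evaluated at the next
  -- eigenvector, which is orthogonal to the family, it says that the next eigenvalue is no smaller.
  record EigenFamily {n} (A : Matrix n) (k : ℕ) : Set where
    field
      value       : Vector Carrier k
      vector      : Fin k → Vector Carrier n
      orthonormal : Orthonormal vector
      eigen       : ∀ i → Eigenspace A (value i) (vector i)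
      antitonic   : Antitonic₁ Fin._≤_ _≤_ value
      extremal    : ∀ w → (∀ i → vector i ∙ w ≈ 0#) → ∀ i → value i * (w ∙ w) ≤ w ∙ (A *ⱽ w)

  eigenvalue-∙ : ∀ {n} (A : Matrix n) {μ v} → Eigenspace A μ v → ∀ w → w ∙ (A *ⱽ v) ≈ μ * (w ∙ v)
  eigenvalue-∙ A {μ} {v} eigen w = trans (∙-congˡ w eigen) (∙-⊛ʳ w μ v)

  distinct-eigenvalues-⊥ : ∀ {n} (B : Matrix n) → IsSymmetric B → ∀ {μ τ u v} → ¬ (τ ≈ μ) →
                           Eigenspace B τ u → Eigenspace B μ v → u ∙ v ≈ 0#
  distinct-eigenvalues-⊥ B B-sym {μ} {τ} {u} {v} τ≉μ eigen-u eigen-v =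
    x≉0⇒y≈0 {τ - μ} (λ eq → τ≉μ (trans (solve 2 (λ t m → t := t :- m :+ m) refl τ μ) (trans (+-congʳ eq) (+-identityˡ μ)))) (begin
      (τ - μ) * (u ∙ v)            ≈⟨ solve 3 (λ t m x → (t :- m) :* x := t :* x :- m :* x) refl τ μ (u ∙ v) ⟩
      τ * (u ∙ v) - μ * (u ∙ v)    ≈⟨ +-cong (trans (*-congˡ (∙-comm u v)) (sym (eigenvalue-∙ B eigen-u v))) (-‿cong (sym (eigenvalue-∙ B eigen-v u))) ⟩
      v ∙ (B *ⱽ u) - u ∙ (B *ⱽ v)  ≈⟨ +-congʳ (symmetric-∙ {A = B} B-sym v u) ⟩
      u ∙ (B *ⱽ v) - u ∙ (B *ⱽ v)  ≈⟨ solve 1 (λ x → x :- x := con (+ 0)) refl (u ∙ (B *ⱽ v)) ⟩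
      0#                           ∎)
    where open ≈-R

  cons-family : ∀ {n} {A : Matrix n} {k} (F : EigenFamily A k) →
                ∀ μ v → v ∙ v ≈ 1# → Eigenspace A μ v → (∀ i → EigenFamily.vector F i ∙ v ≈ 0#) →
                (∀ w → (∀ i → EigenFamily.vector F i ∙ w ≈ 0#) → μ * (w ∙ w) ≤ w ∙ (A *ⱽ w)) →
                EigenFamily A (suc k)
  cons-family {A = A} F μ v unit eigen-v v⊥ lower = record
    { value       = μ ∷ᶠ value
    ; vector      = v ∷ᶠ vector
    ; orthonormal = λ where
        zero    zero    → unit
        zero    (suc j) → trans (∙-comm v (vector j)) (v⊥ j)
        (suc i) zero    → v⊥ i
        (suc i) (suc j) → orthonormal i j
    ; eigen       = λ where
        zero    → eigen-v
        (suc i) → eigen i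
    ; antitonic   = λ {i} {j} → antitonic′ i j
    ; extremal    = λ where
        w w⊥ zero    → lower w (w⊥ ∘ suc)
        w w⊥ (suc i) → extremal w (w⊥ ∘ suc) i
    }
    where
    open EigenFamily F
    antitonic′ : ∀ i j → j Fin.≤ i → (μ ∷ᶠ value) i ≤ (μ ∷ᶠ value) j
    antitonic′ zero    zero    _   = ≤-refl
    antitonic′ (suc i) zero    _   = ≤-resp (trans (*-congˡ unit) (*-identityʳ (value i)))
                                            (trans (eigenvalue-∙ A eigen-v v) (trans (*-congˡ unit) (*-identityʳ μ)))
                                            (extremal v v⊥ i)
    antitonic′ (suc i) (suc j) j≤i = antitonic (ℕ.s≤s⁻¹ j≤i)

  -- Adding (τ − λᵢ)uᵢuᵢᵀ moves the known eigenvalues to τ, and the trace forces the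
  -- least eigenvalue of the result below τ once τ is large; its eigenvector is
  -- then orthogonal to the known ones.
  extend-family : ∀ {n} (A : Matrix n) → IsSymmetric A → ∀ {k} → k ℕ.< n → EigenFamily A k → EigenFamily A (suc k)
  extend-family {suc n} A A-sym {k} (ℕ.s≤s k≤n) F = add (least-eigenvector B zero (deflate-sym A-sym))
    where
    open EigenFamily F
    s = tr A - ∑[ i < k ] value i
    -- The deflated matrix, of size n + 1, has trace s + kτ with k ≤ n. If its least eigenvalue were
    -- at least τ ≥ 0, then (n + 1)τ ≤ s + nτ, so τ ≤ s. Hence τ has to be nonnegative and exceed s,
    -- and 1 + s² does both for either sign of s.
    τ = 1# + s * s
    0≤τ : 0# ≤ τ
    0≤τ = +-nonneg 0≤1 (sq-nonneg s)
    s<τ : s < τ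
    s<τ τ≤s = 0<1 (≤-trans (≤+nonneg (sq-nonneg s) refl) (≤-trans τ≤s s≤0))
      where
      -- Since (s - 1)² + (s - τ) = -s, assuming τ ≤ s forces s ≤ 0, although τ ≥ 1.
      s≤0 : s ≤ 0#
      s≤0 = 0≤-⇒≤ (≤-trans (+-nonneg (sq-nonneg (s - 1#)) (≤⇒0≤- τ≤s)) (≤-reflexive
        (solve 1 (λ s → (s :- con (+ 1)) :* (s :- con (+ 1)) :+ (s :- (con (+ 1) :+ s :* s)) := con (+ 0) :- s) refl s)))
    open Deflation A (λ i → τ - value i) vector
    add : ∃[ μ ] ∃[ v ] (v ∙ v ≈ 1# × Eigenspace B μ v × LowerBound B μ) → EigenFamily A (suc k)
    add (μ , v , unit , eigen-v , lb) = cons-family F μ v unit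
        (λ i → trans (sym (deflate-⊥ v v⊥ i)) (eigen-v i)) v⊥
        (λ w w⊥ → ≤-trans (lb w) (≤-reflexive (∙-congˡ w (deflate-⊥ w w⊥))))
      where
      open ≈-R
      traces : tr B ≈ s + k · τ
      traces = begin
        tr B                                                 ≈⟨ deflate-trace orthonormal ⟩
        tr A + ∑[ i < k ] (τ - value i)                      ≈⟨ +-congˡ (∑-distrib-- (λ _ → τ) value) ⟩
        tr A + (∑[ i < k ] τ - ∑[ i < k ] value i)           ≈⟨ solve 3 (λ a t v → a :+ (t :- v) := a :- v :+ t) refl (tr A) (∑[ i < k ] τ) (∑[ i < k ] value i) ⟩
        s + ∑[ i < k ] τ                                     ≈⟨ +-congˡ (sum-replicate k) ⟩
        s + k · τ                                            ∎
      μ<τ : μ < τ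
      μ<τ τ≤μ = s<τ (≤-resp (cancel τ) (cancel s) (+-monoʳ-≤ (- (n · τ)) (≤-trans (·-mono n) (≤-trans (trace-bound B μ lb)
          (≤-trans (≤-reflexive traces) (+-monoʳ-≤ s (·-monoˡ-≤ 0≤τ k≤n)))))))
        where
        cancel : ∀ x → - (n · τ) + (x + n · τ) ≈ x
        cancel x = solve 2 (λ x y → :- y :+ (x :+ y) := x) refl x (n · τ)
        ·-mono′ : ∀ m → m · τ ≤ m · μ
        ·-mono′ zero    = ≤-refl
        ·-mono′ (suc m) = +-mono-≤ τ≤μ (·-mono′ m)
        ·-mono : ∀ m → τ + m · τ ≤ suc m · μ
        ·-mono m = ·-mono′ (suc m)
      v⊥ : ∀ i → vector i ∙ v ≈ 0#
      v⊥ i = distinct-eigenvalues-⊥ B (deflate-sym A-sym) (<⇒≉ μ<τ)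
        (λ a → trans (deflate-eigen orthonormal i (eigen i) a) (*-congʳ (solve 2 (λ l t → l :+ (t :- l) := t) refl (value i) τ))) eigen-v

  empty-family : ∀ {n} (A : Matrix n) → EigenFamily A 0
  empty-family A = record
    { value       = λ ()
    ; vector      = λ ()
    ; orthonormal = λ ()
    ; eigen       = λ ()
    ; antitonic   = λ { {()} }
    ; extremal    = λ _ _ ()
    }

  eigenbasis : ∀ {n} (A : Matrix n) → IsSymmetric A → EigenFamily A n
  eigenbasis {n} A A-sym = build n ℕ.≤-refl
    where
    build : ∀ k → k ℕ.≤ n → EigenFamily A k
    build zero    _   = empty-family A
    build (suc k) k<n = extend-family A A-sym k<n (build k (ℕ.<⇒≤ k<n))

  -- Uniqueness of the spectrum

  δ-injective : ∀ {m n} (f : Fin m → Fin n) → (∀ {i j} → f i ≡ f j → i ≡ j) → ∀ i j → δ (f i) (f j) ≈ δ i j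
  δ-injective f f-inj i j with i Fin.≟ j
  ... | yes ≡.refl = trans (δ-refl (f i)) (sym (δ-refl i))
  ... | no  i≢j    = trans (δ-≢ (i≢j ∘ f-inj)) (sym (δ-≢ i≢j))

  lookup-injective : ∀ {A : Set} {xs : List A} → Unique xs → ∀ {i j} → lookup xs i ≡ lookup xs j → i ≡ j
  lookup-injective (_  ∷ _)  {zero}  {zero}  eq = ≡.refl
  lookup-injective (x≢ ∷ _)  {zero}  {suc j} eq = contradiction eq (All.lookup x≢ (∈-lookup j))
  lookup-injective (x≢ ∷ _)  {suc i} {zero}  eq = contradiction (≡.sym eq) (All.lookup x≢ (∈-lookup i))
  lookup-injective (_  ∷ xs) {suc i} {suc j} eq = ≡.cong suc (lookup-injective xs eq)

  ∑-lookup-filter : ∀ {A : Set} {P : Pred A 0ℓ} (P? : Decidable P) (g : A → Carrier) →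
                    (∀ x → ¬ P x → g x ≈ 0#) → ∀ xs →
                    ∑[ j < length (filter P? xs) ] g (lookup (filter P? xs) j) ≈ ∑[ j < length xs ] g (lookup xs j)
  ∑-lookup-filter P? g g≈0 []       = refl
  ∑-lookup-filter P? g g≈0 (x ∷ xs) with P? x
  ... | yes _  = +-congˡ (∑-lookup-filter P? g g≈0 xs)
  ... | no  ¬p = trans (∑-lookup-filter P? g g≈0 xs) (sym (trans (+-congʳ (g≈0 x ¬p)) (+-identityˡ _)))

  ∑-lookup-tabulate : ∀ {n} {A : Set} (g : A → Carrier) (f : Fin n → A) →
                      ∑[ j < length (tabulate f) ] g (lookup (tabulate f) j) ≈ ∑[ i < n ] g (f i)
  ∑-lookup-tabulate {zero}  g f = refl
  ∑-lookup-tabulate {suc n} g f = +-congˡ (∑-lookup-tabulate g (f ∘ suc))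

  module Spectral {n} {A : Matrix n} (A-sym : IsSymmetric A) (F : EigenFamily A n) where
    open EigenFamily F

    module _ (μ : Carrier) where
      -- `multiplicity` is the length of exactly this list, so a basis indexed by its positions has
      -- the size that `IsSpectrum` prescribes.
      indices : List (Fin n)
      indices = filter (λ i → value i ≟ μ) (allFin n)

      basis : Fin (length indices) → Vector Carrier n
      basis j = vector (lookup indices j)

      basis-orthonormal : Orthonormal basis
      basis-orthonormal i j = trans (orthonormal (lookup indices i) (lookup indices j))
        (δ-injective (lookup indices) (lookup-injective (Unique.filter⁺ (λ i → value i ≟ μ) (Unique.allFin⁺ n))) i j)

      basis-eigen : ∀ j → Eigenspace A μ (basis j)
      basis-eigen j a = trans (eigen (lookup indices j) a)
        (*-congʳ (All.lookup (All.all-filter (λ i → value i ≟ μ) (allFin n)) (∈-lookup j)))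

      basis-independent : ∀ c → (∀ a → combination c basis a ≈ 0#) → ∀ j → c j ≈ 0#
      basis-independent c eq j = trans (sym (orthonormal-∙-combination {u = basis} basis-orthonormal c j))
        (∑-zero (λ a → trans (*-congˡ {basis j a} (eq a)) (zeroʳ (basis j a))))

      -- In the expansion over the full eigenbasis the terms with eigenvalue other than `μ` vanish
      -- by orthogonality, so filtering them out leaves the sum unchanged.
      basis-spans : ∀ v → Eigenspace A μ v → v ≈ⱽ combination (λ j → basis j ∙ v) basis
      basis-spans v eigen-v a = begin
        v a                                                     ≈⟨ orthonormal-expansion {u = vector} orthonormal v a ⟩
        ∑[ i < n ] g i                                          ≈⟨ ∑-lookup-tabulate g id ⟨
        ∑[ j < length (allFin n) ] g (lookup (allFin n) j)      ≈⟨ ∑-lookup-filter (λ i → value i ≟ μ) g g≈0 (allFin n) ⟨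
        ∑[ j < length indices ] g (lookup indices j)            ∎
        where
        open ≈-R
        g : Fin n → Carrier
        g i = (vector i ∙ v) * vector i a
        g≈0 : ∀ i → ¬ (value i ≈ μ) → g i ≈ 0#
        g≈0 i ne = trans (*-congʳ (distinct-eigenvalues-⊥ A A-sym ne (eigen i) eigen-v)) (zeroˡ (vector i a))

    isSpectrum : IsSpectrum A value
    isSpectrum = antitonic , λ μ →
      basis μ , basis-eigen μ , basis-independent μ , λ v eigen-v → (λ j → basis μ j ∙ v) , basis-spans μ v eigen-v

  ·1-mono-< : ∀ {m n} → m ℕ.< n → m · 1# < n · 1#
  ·1-mono-< {m} {n} m<n n≤m = 0<1 (≤-resp (cancel 1#) (cancel′ (m · 1#)) (+-monoʳ-≤ (- (m · 1#)) (≤-trans (·-monoˡ-≤ 0≤1 m<n) n≤m)))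
    where
    cancel : ∀ x → - (m · 1#) + (x + m · 1#) ≈ x
    cancel x = solve 2 (λ x y → :- y :+ (x :+ y) := x) refl x (m · 1#)
    cancel′ : ∀ x → - x + x ≈ 0#
    cancel′ = solve 1 (λ x → :- x :+ x := con (+ 0)) refl

  -- An ordered field has characteristic zero; this turns an equality of traces into an equality of
  -- dimensions.
  ·1-injective : ∀ {m n} → m · 1# ≈ n · 1# → m ≡ n
  ·1-injective {m} {n} eq with ℕ.<-cmp m n
  ... | tri< m<n _ _ = contradiction (≤-reflexive (sym eq)) (·1-mono-< m<n)
  ... | tri≈ _ m≡n _ = m≡n
  ... | tri> _ _ n<m = contradiction (≤-reflexive eq) (·1-mono-< n<m)

  -- Substituting one expansion into the other writes `b j` through `b` with the coefficients of row
  -- j of DC. Subtracting `b j` leaves a linear relation, which independence makes trivial.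
  change-of-basis : ∀ {n d d′} (b : Fin d → Vector Carrier n) (b′ : Fin d′ → Vector Carrier n) →
    (∀ c → (∀ x → combination c b x ≈ 0#) → ∀ j → c j ≈ 0#) →
    (C : Fin d′ → Vector Carrier d) → (∀ i → b′ i ≈ⱽ combination (C i) b) →
    (D : Fin d → Vector Carrier d′) → (∀ j → b j ≈ⱽ combination (D j) b′) →
    ∀ j → combination (D j) C ≈ⱽ δ j
  change-of-basis {n} {d} {d′} b b′ independent C b′≈ D b≈ j k = begin
    combination (D j) C k                 ≈⟨ solve 2 (λ x y → x := x :- y :+ y) refl (combination (D j) C k) (δ j k) ⟩
    e k + δ j k                           ≈⟨ +-congʳ (independent e vanishes k) ⟩
    0# + δ j k                            ≈⟨ +-identityˡ (δ j k) ⟩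
    δ j k                                 ∎
    where
    open ≈-R
    e : Vector Carrier d
    e k = combination (D j) C k - δ j k
    vanishes : ∀ x → combination e b x ≈ 0#
    vanishes x = begin
      ∑[ k < d ] (e k * b k x)
        ≈⟨ sum-cong-≋ (λ k → solve 3 (λ p q y → (p :- q) :* y := p :* y :- q :* y) refl (combination (D j) C k) (δ j k) (b k x)) ⟩
      ∑[ k < d ] (combination (D j) C k * b k x - δ j k * b k x)
        ≈⟨ ∑-distrib-- (λ k → combination (D j) C k * b k x) (λ k → δ j k * b k x) ⟩
      combination (D j) C ∙ (λ k → b k x) - ∑[ k < d ] (δ j k * b k x)
        ≈⟨ +-cong (combination-∙ (D j) C (λ k → b k x)) (-‿cong (∑-δˡ j (λ k → b k x))) ⟩
      ∑[ i < d′ ] (D j i * combination (C i) b x) - b j x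
        ≈⟨ +-congʳ (trans (sum-cong-≋ (λ i → *-congˡ {D j i} (sym (b′≈ i x)))) (sym (b≈ j x))) ⟩
      b j x - b j x
        ≈⟨ solve 1 (λ y → y :- y := con (+ 0)) refl (b j x) ⟩
      0# ∎

  -- Two bases are related by matrices C, D with CD = 1 and DC = 1, and tr CD = tr DC.
  dimension-unique : ∀ {n} {S : Pred (Vector Carrier n) 0ℓ} {d d′} → HasDimension S d → HasDimension S d′ → d ≡ d′
  dimension-unique {n} {S} {d} {d′} (b , b∈S , b-ind , b-spans) (b′ , b′∈S , b′-ind , b′-spans) = ·1-injective (begin
      d · 1#                                    ≈⟨ sum-replicate d ⟨
      ∑[ j < d ] 1#                             ≈⟨ sum-cong-≋ (λ j → trans (change-of-basis b b′ b-ind C C≈ D D≈ j j) (δ-refl j)) ⟨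
      ∑[ j < d ] ∑[ i < d′ ] (D j i * C i j)    ≈⟨ ∑-comm (λ j i → D j i * C i j) ⟩
      ∑[ i < d′ ] ∑[ j < d ] (D j i * C i j)    ≈⟨ sum-cong-≋ (λ i → sum-cong-≋ (λ j → *-comm (D j i) (C i j))) ⟩
      ∑[ i < d′ ] ∑[ j < d ] (C i j * D j i)    ≈⟨ sum-cong-≋ (λ i → trans (change-of-basis b′ b b′-ind D D≈ C C≈ i i) (δ-refl i)) ⟩
      ∑[ i < d′ ] 1#                            ≈⟨ sum-replicate d′ ⟩
      d′ · 1#                                   ∎)
    where
    open ≈-R
    C : Fin d′ → Vector Carrier d
    C i = proj₁ (b-spans (b′ i) (b′∈S i))
    C≈ : ∀ i → b′ i ≈ⱽ combination (C i) b
    C≈ i = proj₂ (b-spans (b′ i) (b′∈S i))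
    D : Fin d → Vector Carrier d′
    D j = proj₁ (b′-spans (b j) (b∈S j))
    D≈ : ∀ j → b j ≈ⱽ combination (D j) b′
    D≈ j = proj₂ (b′-spans (b j) (b∈S j))

  tick : ∀ {P : Set} → Dec P → ℕ → ℕ
  tick (yes _) = suc
  tick (no _)  = id

  -- A recursive counterpart of `multiplicity`: removing the head of the vector removes one
  -- comparison, whereas filtering `allFin` keeps referring to the original vector.
  count : ∀ {n} → Vector Carrier n → Carrier → ℕ
  count {zero}  f μ = 0
  count {suc n} f μ = tick (f zero ≟ μ) (count (f ∘ suc) μ)

  -- Stated for any `g`, because `allFin` is `tabulate id` and its tail is a tabulation of `suc`.
  multiplicity-count : ∀ {m n} (f : Vector Carrier m) (g : Fin n → Fin m) μ →
                       length (filter (λ i → f i ≟ μ) (tabulate g)) ≡ count (f ∘ g) μ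
  multiplicity-count {n = zero}  f g μ = ≡.refl
  multiplicity-count {n = suc n} f g μ with f (g zero) ≟ μ
  ... | yes _ = ≡.cong suc (multiplicity-count f (g ∘ suc) μ)
  ... | no  _ = multiplicity-count f (g ∘ suc) μ

  count-∈ : ∀ {n} (f : Vector Carrier n) μ {k} → count f μ ≡ suc k → ∃[ i ] f i ≈ μ
  count-∈ {suc n} f μ eq with f zero ≟ μ
  ... | yes p = zero , p
  ... | no  _ = Product.map suc id (count-∈ (f ∘ suc) μ eq)

  count-head : ∀ {n} (f : Vector Carrier (suc n)) → ∃[ k ] count f (f zero) ≡ suc k
  count-head f with f zero ≟ f zero
  ... | yes _  = _ , ≡.refl
  ... | no  ¬p = contradiction refl ¬p

  count-tail : ∀ {n} (f g : Vector Carrier (suc n)) → f zero ≈ g zero → ∀ μ →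
               count f μ ≡ count g μ → count (f ∘ suc) μ ≡ count (g ∘ suc) μ
  count-tail f g f₀≈g₀ μ eq with f zero ≟ μ | g zero ≟ μ
  ... | yes _ | yes _ = ℕ.suc-injective eq
  ... | no  _ | no  _ = eq
  ... | yes p | no ¬q = contradiction (trans (sym f₀≈g₀) p) ¬q
  ... | no ¬p | yes q = contradiction (trans f₀≈g₀ q) ¬p

  -- The head of `f` has positive multiplicity, so it occurs somewhere in `g`, whose head is its
  -- largest entry.
  head≤head : ∀ {n} (f g : Vector Carrier (suc n)) → Antitonic₁ Fin._≤_ _≤_ g →
              (∀ μ → count f μ ≡ count g μ) → f zero ≤ g zero
  head≤head f g g-anti eq = from-index (count-∈ g (f zero) (≡.trans (≡.sym (eq (f zero))) (proj₂ (count-head f))))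
    where
    from-index : ∃[ i ] g i ≈ f zero → f zero ≤ g zero
    from-index (i , p) = ≤-trans (≤-reflexive (sym p)) (g-anti {i} {zero} ℕ.z≤n)

  antitonic-unique : ∀ {n} (f g : Vector Carrier n) → Antitonic₁ Fin._≤_ _≤_ f → Antitonic₁ Fin._≤_ _≤_ g →
                     (∀ μ → count f μ ≡ count g μ) → f ≈ⱽ g
  antitonic-unique {suc n} f g f-anti g-anti eq = λ where
      zero    → f₀≈g₀
      (suc i) → antitonic-unique (f ∘ suc) (g ∘ suc) (λ p → f-anti (ℕ.s≤s p)) (λ p → g-anti (ℕ.s≤s p))
                  (λ μ → count-tail f g f₀≈g₀ μ (eq μ)) i
    where
    f₀≈g₀ : f zero ≈ g zero
    f₀≈g₀ = antisym (head≤head f g g-anti eq) (head≤head g f f-anti (≡.sym ∘ eq))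

  spectrum-unique : ∀ {n} {A : Matrix n} {eig eig′ : Vector Carrier n} →
                    IsSpectrum A eig → IsSpectrum A eig′ → eig ≈ⱽ eig′
  spectrum-unique {A = A} {eig} {eig′} (anti , dim) (anti′ , dim′) = antitonic-unique eig eig′ anti anti′ (λ μ →
    ≡.trans (≡.sym (multiplicity-count eig id μ)) (≡.trans (dimension-unique {S = Eigenspace A μ} (dim μ) (dim′ μ)) (multiplicity-count eig′ id μ)))

  -- The upper bound h ≤ χ

  +-cancelʳ-≤ : ∀ {x y} z → x + z ≤ y + z → x ≤ y
  +-cancelʳ-≤ {x} {y} z p = ≤-resp (cancel x) (cancel y) (+-monoʳ-≤ (- z) p)
    where
    cancel : ∀ x → - z + (x + z) ≈ x
    cancel x = solve 2 (λ x z → :- z :+ (x :+ z) := x) refl x z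

  -- The indicator of i < k. Its recursion follows that of `inject≤`, so a sum over the first k
  -- entries becomes a weighted sum over all of them.
  below : ∀ {n} → ℕ → Fin n → Carrier
  below zero    i       = 0#
  below (suc k) zero    = 1#
  below (suc k) (suc i) = below k i

  below-< : ∀ {n} k (i : Fin n) → toℕ i ℕ.< k → below k i ≈ 1#
  below-< (suc k) zero    _         = refl
  below-< (suc k) (suc i) (ℕ.s≤s p) = below-< k i p

  below-≥ : ∀ {n} k (i : Fin n) → k ℕ.≤ toℕ i → below k i ≈ 0#
  below-≥ zero    i       _         = refl
  below-≥ (suc k) (suc i) (ℕ.s≤s p) = below-≥ k i p

  ∑-inject≤ : ∀ {k n} .(k≤n : k ℕ.≤ n) (f : Vector Carrier n) →
              ∑[ i < k ] f (inject≤ i k≤n) ≈ ∑[ i < n ] (f i * below k i)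
  ∑-inject≤ {zero}          k≤n f = sym (∑-zero (λ i → zeroʳ (f i)))
  ∑-inject≤ {suc k} {suc n} k≤n f = +-cong (sym (*-identityʳ (f zero))) (∑-inject≤ (ℕ.s≤s⁻¹ k≤n) (f ∘ suc))

  ∑-below : ∀ {k n} → k ℕ.≤ n → ∑[ i < n ] below k i ≈ k · 1#
  ∑-below {k} {n} k≤n = trans (sum-cong-≋ {n} (λ i → sym (*-identityˡ (below k i))))
    (trans (sym (∑-inject≤ k≤n (λ _ → 1#))) (sum-replicate k))

  -- With t = f k, every term of Σ (f i − t)(q i − [i < k]) is nonnegative.
  monotone-weighted-sum : ∀ {n k} (k<n : k ℕ.< n) (f q : Vector Carrier n) → (∀ {i j} → i Fin.≤ j → f i ≤ f j) →
    (∀ i → 0# ≤ q i) → (∀ i → q i ≤ 1#) → ∑[ i < n ] q i ≈ k · 1# →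
    ∑[ i < k ] f (inject≤ i (ℕ.<⇒≤ k<n)) ≤ ∑[ i < n ] (f i * q i)
  monotone-weighted-sum {n} {k} k<n f q mono 0≤q q≤1 ∑q = ≤-trans (≤-reflexive (∑-inject≤ (ℕ.<⇒≤ k<n) f))
      (+-cancelʳ-≤ (t * (k · 1#)) (≤-resp (split q ∑q (below k)) (split (below k) (∑-below (ℕ.<⇒≤ k<n)) q) (∑-mono-≤ term)))
    where
    t = f (fromℕ< k<n)
    -- Both weights have total k, so adding t times the other weight to either side contributes the
    -- same tk, which cancels. This avoids subtraction in the termwise comparison.
    split : ∀ (a : Vector Carrier n) → ∑[ i < n ] a i ≈ k · 1# → ∀ (b : Vector Carrier n) →
            ∑[ i < n ] (f i * b i + t * a i) ≈ ∑[ i < n ] (f i * b i) + t * (k · 1#)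
    split a ∑a b = trans (∑-distrib-+ (λ i → f i * b i) (λ i → t * a i))
      (+-congˡ (trans (sym (*-distribˡ-sum t a)) (*-congˡ ∑a)))
    exchange : ∀ {x y q b} → 0# ≤ (x - y) * (q - b) → x * b + y * q ≤ x * q + y * b
    exchange {x} {y} {q} {b} p = ≤+nonneg p
      (solve 4 (λ x y q b → x :* q :+ y :* b := x :* b :+ y :* q :+ (x :- y) :* (q :- b)) refl x y q b)
    small : ∀ i → toℕ i ℕ.< k → f i ≤ t
    small i i<k = mono (≡.subst (toℕ i ℕ.≤_) (≡.sym (Fin.toℕ-fromℕ< k<n)) (ℕ.<⇒≤ i<k))
    large : ∀ i → k ℕ.≤ toℕ i → t ≤ f i
    large i k≤i = mono (≡.subst (ℕ._≤ toℕ i) (≡.sym (Fin.toℕ-fromℕ< k<n)) k≤i)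
    term : ∀ i → f i * below k i + t * q i ≤ f i * q i + t * below k i
    term i = case toℕ i ℕ.<? k of λ where
      (yes i<k) → exchange (≤-trans (*-nonneg (≤⇒0≤- (small i i<k)) (≤⇒0≤- (≤-trans (q≤1 i) (≤-reflexive (sym (below-< k i i<k))))))
        (≤-reflexive (solve 4 (λ x y q b → (y :- x) :* (b :- q) := (x :- y) :* (q :- b)) refl (f i) t (q i) (below k i))))
      (no i≮k) → exchange (*-nonneg (≤⇒0≤- (large i (ℕ.≮⇒≥ i≮k)))
        (≤⇒0≤- (≤-trans (≤-reflexive (below-≥ k i (ℕ.≮⇒≥ i≮k))) (0≤q i))))

  opposite-antitone : ∀ {n} {i j : Fin n} → i Fin.≤ j → opposite j Fin.≤ opposite i
  opposite-antitone {n} {i} {j} i≤j = ≡.subst₂ ℕ._≤_ (≡.sym (Fin.opposite-prop j)) (≡.sym (Fin.opposite-prop i))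
    (ℕ.∸-monoʳ-≤ n (ℕ.s≤s i≤j))

  -- The scalar core of Ky Fan's minimum principle. Reversing the indices makes `f` increasing and
  -- moves its k smallest entries to the front.
  ky-fan : ∀ {n k} (k<n : k ℕ.< n) (f q : Vector Carrier n) → Antitonic₁ Fin._≤_ _≤_ f →
    (∀ i → 0# ≤ q i) → (∀ i → q i ≤ 1#) → ∑[ i < n ] q i ≈ k · 1# →
    ∑[ i < k ] f (opposite (inject≤ i (ℕ.<⇒≤ k<n))) ≤ ∑[ i < n ] (f i * q i)
  ky-fan {n} k<n f q anti 0≤q q≤1 ∑q = ≤-trans
    (monotone-weighted-sum k<n (f ∘ opposite) (q ∘ opposite) (anti ∘ opposite-antitone) (0≤q ∘ opposite) (q≤1 ∘ opposite)
      (trans (sym (∑-permute q Perm.reverse)) ∑q))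
    (≤-reflexive (sym (∑-permute (λ i → f i * q i) Perm.reverse)))

  spectral-form : ∀ {n} {A : Matrix n} → IsSymmetric A → (F : EigenFamily A n) → ∀ v →
                  v ∙ (A *ⱽ v) ≈ ∑[ i < n ] (EigenFamily.value F i * ((EigenFamily.vector F i ∙ v) * (EigenFamily.vector F i ∙ v)))
  spectral-form {n} {A} A-sym F v = trans (parseval {u = vector} orthonormal v (A *ⱽ v)) (sum-cong-≋ (λ i → begin
    (vector i ∙ v) * (vector i ∙ (A *ⱽ v))          ≈⟨ *-congˡ {vector i ∙ v} (trans (symmetric-∙ {A = A} A-sym (vector i) v)
                                                         (trans (eigenvalue-∙ A (eigen i) v) (*-congˡ (∙-comm v (vector i))))) ⟩
    (vector i ∙ v) * (value i * (vector i ∙ v))     ≈⟨ solve 2 (λ l x → x :* (l :* x) := l :* (x :* x)) refl (value i) (vector i ∙ v) ⟩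
    value i * ((vector i ∙ v) * (vector i ∙ v))     ∎))
    where
    open EigenFamily F
    open ≈-R

  SupportedOn : ∀ {n} → Pred (Fin n) 0ℓ → Vector Carrier n → Set
  SupportedOn S v = ∀ i → ¬ S i → v i ≈ 0#

  -- Where `z` vanishes, the basis vector at `o` stands in with coefficient zero. Every class thus
  -- yields exactly one unit vector, which makes the total weight exactly the number of colours.
  direction : ∀ {n} {S : Pred (Fin n) 0ℓ} o → S o → (z : Vector Carrier n) → SupportedOn S z →
              Σ[ y ∈ Vector Carrier n ] Σ[ α ∈ Carrier ] (y ∙ y ≈ 1# × SupportedOn S y × z ≈ⱽ α ⊛ y)
  direction {n} {S} o o∈S z z-supp = by-cases (z ∙ z ≟ 0#)
    where
    Direction = Σ[ y ∈ Vector Carrier n ] Σ[ α ∈ Carrier ] (y ∙ y ≈ 1# × SupportedOn S y × z ≈ⱽ α ⊛ y)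
    scale : (Σ[ α ∈ Carrier ] Σ[ β ∈ Carrier ] (α * β ≈ 1# × (β ⊛ z) ∙ (β ⊛ z) ≈ 1#)) → Direction
    scale (α , β , αβ≈1 , unit) = β ⊛ z , α , unit
      , (λ i i∉S → trans (*-congˡ (z-supp i i∉S)) (zeroʳ β))
      , λ i → trans (sym (*-identityˡ (z i))) (trans (*-congʳ (sym αβ≈1)) (*-assoc α β (z i)))
    by-cases : Dec (z ∙ z ≈ 0#) → Direction
    by-cases (no  z≉0) = scale (normalise z z≉0)
    by-cases (yes z≈0) = δ o , 0# , δ-norm o
      , (λ i i∉S → δ-≢ {i = o} {i} (λ o≡i → i∉S (≡.subst S o≡i o∈S)))
      , λ i → trans (∙≈0⇒≈0 z z≈0 i) (sym (zeroˡ (δ o i)))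

  module Upper {n k} (G : Graph n) (col : Fin n → Fin k) (proper : ∀ i j → Adj G i j → col i ≢ col j)
               (rep : Fin k → Fin n) (col-rep : ∀ c → col (rep c) ≡ c)
               (Z : Matrix n) (Z-sym : IsSymmetric Z) (Z-supp : ∀ i j → ¬ Adj G i j → Z i j ≈ 0#)
               (F : EigenFamily Z n) (x : Vector Carrier n) (x-unit : x ∙ x ≈ 1#) where
    open EigenFamily F
    open ≈-R

    Class : Fin k → Pred (Fin n) 0ℓ
    Class c i = col i ≡ c

    part : Fin k → Vector Carrier n
    part c i = δ (col i) c * x i

    part-supported : ∀ c → SupportedOn (Class c) (part c)
    part-supported c i i∉c = trans (*-congʳ (δ-≢ i∉c)) (zeroˡ (x i))

    directions : ∀ c → Σ[ y ∈ Vector Carrier n ] Σ[ α ∈ Carrier ] (y ∙ y ≈ 1# × SupportedOn (Class c) y × part c ≈ⱽ α ⊛ y)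
    directions c = direction {S = Class c} (rep c) (col-rep c) (part c) (part-supported c)

    -- Only the properties recorded here matter below; sealing `y` and `α` keeps the square roots
    -- and inverses behind them from unfolding.
    abstract
      y : Fin k → Vector Carrier n
      y c = proj₁ (directions c)

      α : Fin k → Carrier
      α c = proj₁ (proj₂ (directions c))

      y-unit : ∀ c → y c ∙ y c ≈ 1#
      y-unit c = proj₁ (proj₂ (proj₂ (directions c)))

      y-supported : ∀ c → SupportedOn (Class c) (y c)
      y-supported c = proj₁ (proj₂ (proj₂ (proj₂ (directions c))))

      part≈ : ∀ c → part c ≈ⱽ α c ⊛ y c
      part≈ c = proj₂ (proj₂ (proj₂ (proj₂ (directions c))))

    y-orthonormal : Orthonormal y
    y-orthonormal c d = case c Fin.≟ d of λ where
        (yes ≡.refl) → trans (y-unit c) (sym (δ-refl c))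
        (no c≢d)     → trans (∑-zero (disjoint c≢d)) (sym (δ-≢ c≢d))
      where
      disjoint : c ≢ d → ∀ i → y c i * y d i ≈ 0#
      disjoint c≢d i = case col i Fin.≟ c of λ where
        (yes ≡.refl) → trans (*-congˡ (y-supported d i c≢d)) (zeroʳ (y c i))
        (no  i∉c)    → trans (*-congʳ (y-supported c i i∉c)) (zeroˡ (y d i))

    y-isotropic : ∀ c → y c ∙ (Z *ⱽ y c) ≈ 0#
    y-isotropic c = ∑-zero outer
      where
      inner : ∀ i → col i ≡ c → ∀ j → Z i j * y c j ≈ 0#
      inner i i∈c j = case col j Fin.≟ c of λ where
        (yes j∈c) → trans (*-congʳ (Z-supp i j (λ ij → proper i j ij (≡.trans i∈c (≡.sym j∈c))))) (zeroˡ (y c j))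
        (no  j∉c) → trans (*-congˡ (y-supported c j j∉c)) (zeroʳ (Z i j))
      outer : ∀ i → y c i * (Z *ⱽ y c) i ≈ 0#
      outer i = case col i Fin.≟ c of λ where
        (yes i∈c) → trans (*-congˡ (∑-zero (inner i i∈c))) (zeroʳ (y c i))
        (no  i∉c) → trans (*-congʳ (y-supported c i i∉c)) (zeroˡ ((Z *ⱽ y c) i))

    y∙part : ∀ c → y c ∙ x ≈ α c
    y∙part c = begin
      y c ∙ x                 ≈⟨ sum-cong-≋ restrict ⟩
      y c ∙ part c            ≈⟨ ∙-congˡ (y c) (part≈ c) ⟩
      y c ∙ (α c ⊛ y c)       ≈⟨ ∙-⊛ʳ (y c) (α c) (y c) ⟩
      α c * (y c ∙ y c)       ≈⟨ trans (*-congˡ (y-unit c)) (*-identityʳ (α c)) ⟩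
      α c                     ∎
      where
      restrict : ∀ i → y c i * x i ≈ y c i * part c i
      restrict i = case col i Fin.≟ c of λ where
        (yes ≡.refl) → *-congˡ (sym (trans (*-congʳ (δ-refl (col i))) (*-identityˡ (x i))))
        (no  i∉c)    → trans (*-congʳ (y-supported c i i∉c)) (trans (zeroˡ (x i))
                         (sym (trans (*-congʳ (y-supported c i i∉c)) (zeroˡ (part c i)))))

    -- The squared length of the projection of `v` onto the span of the y_c; at the i-th eigenvector
    -- it is pᵢ.
    weight : Vector Carrier n → Carrier
    weight v = ∑[ c < k ] ((y c ∙ v) * (y c ∙ v))

    weight-nonneg : ∀ v → 0# ≤ weight v
    weight-nonneg v = ∑-nonneg (λ c → sq-nonneg (y c ∙ v))

    weight≤1 : ∀ i → weight (vector i) ≤ 1#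
    weight≤1 i = ≤-trans (bessel {u = y} y-orthonormal (vector i)) (≤-reflexive (trans (orthonormal i i) (δ-refl i)))

    -- The eigenvector lies in the span of the y_c. Since y_c∙x = α_c, each square is the inner
    -- product of a part with `x`, and the parts add up to `x`.
    weight-x : weight x ≈ 1#
    weight-x = begin
      ∑[ c < k ] ((y c ∙ x) * (y c ∙ x))          ≈⟨ sum-cong-≋ (λ c → trans (*-congʳ (y∙part c)) (trans (sym (∙-⊛ˡ (α c) (y c) x))
                                                       (∙-cong {v = x} (λ i → sym (part≈ c i)) (λ _ → refl)))) ⟩
      ∑[ c < k ] ∑[ i < n ] (part c i * x i)      ≈⟨ ∑-comm (λ c i → part c i * x i) ⟩
      ∑[ i < n ] ∑[ c < k ] (part c i * x i)      ≈⟨ sum-cong-≋ (λ i → trans (sum-cong-≋ (λ c → *-assoc (δ (col i) c) (x i) (x i))) (∑-δˡ (col i) (λ _ → x i * x i))) ⟩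
      x ∙ x                                       ≈⟨ x-unit ⟩
      1#                                          ∎

    -- The trace of a rank-k projection: after exchanging the sums, Parseval gives 1 for each y_c.
    ∑-weight : ∑[ i < n ] weight (vector i) ≈ k · 1#
    ∑-weight = begin
      ∑[ i < n ] ∑[ c < k ] ((y c ∙ vector i) * (y c ∙ vector i))     ≈⟨ ∑-comm (λ i c → (y c ∙ vector i) * (y c ∙ vector i)) ⟩
      ∑[ c < k ] ∑[ i < n ] ((y c ∙ vector i) * (y c ∙ vector i))     ≈⟨ sum-cong-≋ (λ c → sum-cong-≋ (λ i → *-cong (∙-comm (y c) (vector i)) (∙-comm (y c) (vector i)))) ⟩
      ∑[ c < k ] ∑[ i < n ] ((vector i ∙ y c) * (vector i ∙ y c))     ≈⟨ sum-cong-≋ (λ c → trans (sym (parseval {u = vector} orthonormal (y c) (y c))) (y-unit c)) ⟩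
      ∑[ c < k ] 1#                                                   ≈⟨ sum-replicate k ⟩
      k · 1#                                                          ∎

    -- After exchanging the sums, the inner sum is the quadratic form of `Z` at y_c in spectral
    -- coordinates.
    ∑-value-weight : ∑[ i < n ] (value i * weight (vector i)) ≈ 0#
    ∑-value-weight = begin
      ∑[ i < n ] (value i * weight (vector i))
        ≈⟨ sum-cong-≋ (λ i → *-distribˡ-sum (value i) (λ c → (y c ∙ vector i) * (y c ∙ vector i))) ⟩
      ∑[ i < n ] ∑[ c < k ] (value i * ((y c ∙ vector i) * (y c ∙ vector i)))
        ≈⟨ ∑-comm (λ i c → value i * ((y c ∙ vector i) * (y c ∙ vector i))) ⟩
      ∑[ c < k ] ∑[ i < n ] (value i * ((y c ∙ vector i) * (y c ∙ vector i)))
        ≈⟨ sum-cong-≋ (λ c → sum-cong-≋ (λ i → *-congˡ {value i} (*-cong (∙-comm (y c) (vector i)) (∙-comm (y c) (vector i))))) ⟩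
      ∑[ c < k ] ∑[ i < n ] (value i * ((vector i ∙ y c) * (vector i ∙ y c)))
        ≈⟨ sum-cong-≋ (λ c → trans (sym (spectral-form {A = Z} Z-sym F (y c))) (y-isotropic c)) ⟩
      ∑[ c < k ] 0#
        ≈⟨ ∑-zero {k} (λ _ → refl) ⟩
      0# ∎

  -- The weights p sum to k + 1 with p₀ = 1, so the remaining ones sum to k.
  weighted-bound : ∀ {n k} (k<n : k ℕ.< suc n) (f p : Vector Carrier (suc n)) → Antitonic₁ Fin._≤_ _≤_ f →
    (∀ i → 0# ≤ p i) → (∀ i → p i ≤ 1#) → p zero ≈ 1# →
    ∑[ i < suc n ] p i ≈ suc k · 1# → ∑[ i < suc n ] (f i * p i) ≈ 0# →
    f zero + ∑[ i < k ] f (opposite (inject≤ i (ℕ.<⇒≤ k<n))) ≤ 0#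
  weighted-bound {n} {k} k<n f p anti 0≤p p≤1 p₀≈1 ∑p ∑fp = ≤-trans
    (+-monoʳ-≤ (f zero) (ky-fan k<n f q anti 0≤q q≤1 ∑q)) (≤-reflexive (begin
      f zero + (f zero * 0# + ∑[ i < n ] (f (suc i) * p (suc i)))  ≈⟨ +-cong (trans (sym (*-identityʳ (f zero))) (*-congˡ (sym p₀≈1))) (trans (+-congʳ (zeroʳ (f zero))) (+-identityˡ _)) ⟩
      f zero * p zero + ∑[ i < n ] (f (suc i) * p (suc i))         ≈⟨ ∑fp ⟩
      0#                                                           ∎))
    where
    open ≈-R
    q : Vector Carrier (suc n)
    -- The zero at the head removes λ₁ from the weighted sum while keeping all n + 1 entries, so
    -- `ky-fan` still speaks of the smallest eigenvalues of the whole spectrum.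
    q = 0# ∷ᶠ (p ∘ suc)
    0≤q : ∀ i → 0# ≤ q i
    0≤q zero    = ≤-refl
    0≤q (suc i) = 0≤p (suc i)
    q≤1 : ∀ i → q i ≤ 1#
    q≤1 zero    = 0≤1
    q≤1 (suc i) = p≤1 (suc i)
    ∑q : ∑[ i < suc n ] q i ≈ k · 1#
    ∑q = begin
      0# + ∑[ i < n ] p (suc i)                         ≈⟨ solve 2 (λ a b → con (+ 0) :+ b := :- a :+ (a :+ b)) refl 1# (∑[ i < n ] p (suc i)) ⟩
      - 1# + (1# + ∑[ i < n ] p (suc i))                ≈⟨ +-congˡ (trans (+-congʳ (sym p₀≈1)) ∑p) ⟩
      - 1# + (1# + k · 1#)                              ≈⟨ solve 2 (λ a b → :- a :+ (a :+ b) := b) refl 1# (k · 1#) ⟩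
      k · 1#                                            ∎

  surjective-colouring-bound : ∀ {n k} (G : Graph (suc n)) (col : Fin (suc n) → Fin (suc k)) →
    (∀ i j → Adj G i j → col i ≢ col j) → (∀ c → ∃[ i ] col i ≡ c) → SpectralBound G (suc k)
  surjective-colouring-bound {n} {k} G col proper surj = ℕ.<⇒≤ k<n , bound
    where
    rep : Fin (suc k) → Fin (suc n)
    rep c = proj₁ (surj c)
    col-rep : ∀ c → col (rep c) ≡ c
    col-rep c = proj₂ (surj c)
    k<n : k ℕ.< suc n
    -- Representatives of distinct colours are distinct, so the k + 1 colours do not outnumber the
    -- vertices.
    k<n = Fin.injective⇒≤ {f = rep} (λ {c} {d} eq → ≡.trans (≡.sym (col-rep c)) (≡.trans (≡.cong col eq) (col-rep d)))
    bound : ∀ Z → IsSymmetric Z → (∀ i j → ¬ Adj G i j → Z i j ≈ 0#) → ∀ eig → IsSpectrum Z eig →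
            eig zero + ∑[ i < k ] eig (opposite (inject≤ i (ℕ.<⇒≤ k<n))) ≤ 0#
    bound Z Z-sym Z-supp eig spec = for-family (eigenbasis Z Z-sym)
      where
      for-family : EigenFamily Z (suc n) → eig zero + ∑[ i < k ] eig (opposite (inject≤ i (ℕ.<⇒≤ k<n))) ≤ 0#
      for-family F = ≤-resp (+-cong (value≈eig zero) (sum-cong-≋ (λ i → value≈eig (opposite (inject≤ i (ℕ.<⇒≤ k<n)))))) refl
          (weighted-bound k<n value (weight ∘ vector) antitonic (weight-nonneg ∘ vector) weight≤1 weight-x ∑-weight ∑-value-weight)
        where
        open EigenFamily F
        open Upper G col proper rep col-rep Z Z-sym Z-supp F (vector zero) (orthonormal zero zero)
        value≈eig : value ≈ⱽ eig
        value≈eig = spectrum-unique {A = Z} (Spectral.isSpectrum {A = Z} Z-sym F) spec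

  minimal-colouring-surjective : ∀ {n k} (G : Graph n) (col : Fin n → Fin (suc k)) →
    (∀ i j → Adj G i j → col i ≢ col j) → (∀ m → Colourable G m → suc k ℕ.≤ m) → ∀ c → ∃[ i ] col i ≡ c
  minimal-colouring-surjective {n} {k} G col proper least c with Fin.any? (λ i → col i Fin.≟ c)
  ... | yes found = found
  ... | no  miss  = contradiction (least k (recolour , proper′)) (ℕ.<⇒≱ ℕ.≤-refl)
    where
    missed : ∀ i → c ≢ col i
    missed i eq = miss (i , ≡.sym eq)
    recolour : Fin n → Fin k
    recolour i = punchOut (missed i)
    proper′ : ∀ i j → Adj G i j → recolour i ≢ recolour j
    proper′ i j ij eq = proper i j ij (Fin.punchOut-injective (missed i) (missed j) eq)

  chromatic-bound : ∀ {n χ} (G : Graph (suc n)) → IsChromaticNumber G χ → SpectralBound G χ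
  chromatic-bound {χ = zero}  G ((col , _) , _)        = case col zero of λ ()
  chromatic-bound {χ = suc k} G ((col , proper) , least) =
    surjective-colouring-bound G col proper (minimal-colouring-surjective G col proper least)

  -- The lower bound ϑ ≤ h

  rayleigh-≤-first : ∀ {n} {A : Matrix (suc n)} → IsSymmetric A → (F : EigenFamily A (suc n)) →
                     ∀ v → v ∙ (A *ⱽ v) ≤ EigenFamily.value F zero * (v ∙ v)
  rayleigh-≤-first {n} {A} A-sym F v = ≤-trans (≤-reflexive (spectral-form {A = A} A-sym F v)) (≤-trans
    (∑-mono-≤ (λ i → *-monoʳ (sq-nonneg (vector i ∙ v)) (antitonic {i} {zero} ℕ.z≤n)))
    (≤-reflexive (trans (sym (*-distribˡ-sum (value zero) (λ i → (vector i ∙ v) * (vector i ∙ v))))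
      (*-congˡ (sym (parseval {u = vector} orthonormal v v))))))
    where open EigenFamily F

  lowerBound-≤-value : ∀ {n k} {A : Matrix n} {μ} → LowerBound A μ → (F : EigenFamily A k) →
                       ∀ i → μ ≤ EigenFamily.value F i
  lowerBound-≤-value {A = A} {μ} lb F i = ≤-resp (trans (*-congˡ unit) (*-identityʳ μ))
      (trans (eigenvalue-∙ A (eigen i) (vector i)) (trans (*-congˡ unit) (*-identityʳ (value i)))) (lb (vector i))
    where
    open EigenFamily F
    unit : vector i ∙ vector i ≈ 1#
    unit = trans (orthonormal i i) (δ-refl i)

  -- r = 1/√d, with r = 0 where d = 0.
  record InverseRoot (d : Carrier) : Set where
    field
      r s   : Carrier
      s²    : s * s ≈ d
      cases : (d ≈ 0# × r ≈ 0#) ⊎ (r * s ≈ 1#)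

  inverseRoot : ∀ {d} → 0# ≤ d → InverseRoot d
  inverseRoot {d} 0≤d = from-root (sqrt 0≤d)
    where
    from-root : ∃[ s ] (0# ≤ s × s * s ≈ d) → InverseRoot d
    from-root (s , _ , s²) = by-cases (s ≟ 0#)
      where
      from-inverse : ∃[ r ] s * r ≈ 1# → InverseRoot d
      from-inverse (r , sr≈1) = record { r = r ; s = s ; s² = s² ; cases = inj₂ (trans (*-comm r s) sr≈1) }
      by-cases : Dec (s ≈ 0#) → InverseRoot d
      by-cases (yes s≈0) = record { r = 0# ; s = s ; s² = s² ; cases = inj₁ (trans (sym s²) (trans (*-congʳ s≈0) (zeroˡ s)) , refl) }
      by-cases (no  s≉0) = from-inverse (inverse s s≉0)

  module Normalised {n} {X : Matrix n} (X-sym : IsSymmetric X) (X-psd : PositiveSemidefinite X) (X-tr : tr X ≈ 1#)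
                    (root : ∀ i → InverseRoot (X i i)) where
    open ≈-R
    r s : Vector Carrier n
    r i = InverseRoot.r (root i)
    s i = InverseRoot.s (root i)

    s² : ∀ i → s i * s i ≈ X i i
    s² i = InverseRoot.s² (root i)

    ρ : Vector Carrier n
    ρ i = r i * s i

    ρ*X : ∀ i j → ρ i * X i j ≈ X i j
    ρ*X i j = by-cases (InverseRoot.cases (root i))
      where
      by-cases : (X i i ≈ 0# × r i ≈ 0#) ⊎ (r i * s i ≈ 1#) → ρ i * X i j ≈ X i j
      by-cases (inj₂ ρ≈1)     = trans (*-congʳ ρ≈1) (*-identityˡ (X i j))
      by-cases (inj₁ (d≈0 , _)) = trans (*-congˡ Xij≈0) (trans (zeroʳ (ρ i)) (sym Xij≈0))
        where Xij≈0 = psd-zero-row {M = X} X-sym X-psd i d≈0 j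

    r²X≤1 : ∀ i → r i * r i * X i i ≤ 1#
    r²X≤1 i = by-cases (InverseRoot.cases (root i))
      where
      by-cases : (X i i ≈ 0# × r i ≈ 0#) ⊎ (r i * s i ≈ 1#) → r i * r i * X i i ≤ 1#
      by-cases (inj₁ (d≈0 , _)) = ≤-trans (≤-reflexive (trans (*-congˡ d≈0) (zeroʳ (r i * r i)))) 0≤1
      by-cases (inj₂ ρ≈1) = ≤-reflexive (begin
        r i * r i * X i i           ≈⟨ *-congˡ (s² i) ⟨
        r i * r i * (s i * s i)     ≈⟨ solve 2 (λ r s → r :* r :* (s :* s) := r :* s :* (r :* s)) refl (r i) (s i) ⟩
        ρ i * ρ i                   ≈⟨ trans (*-cong ρ≈1 ρ≈1) (*-identityˡ 1#) ⟩
        1#                          ∎)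

    -- The diagonal of `X` is subtracted before scaling, so the diagonal of `Z` is zero even in rows
    -- where `r` is zero.
    Z : Matrix n
    Z i j = r i * r j * (X i j - δ i j * X i i)

    δ*diagonal-sym : ∀ i j → δ i j * X i i ≈ δ j i * X j j
    δ*diagonal-sym i j = case i Fin.≟ j of λ where
      (yes ≡.refl) → refl
      (no  i≢j)    → trans (trans (*-congʳ (δ-≢ i≢j)) (zeroˡ (X i i)))
                       (sym (trans (*-congʳ (δ-≢ (i≢j ∘ ≡.sym))) (zeroˡ (X j j))))

    Z-sym : IsSymmetric Z
    Z-sym i j = *-cong (*-comm (r i) (r j)) (+-cong (X-sym i j) (-‿cong (δ*diagonal-sym i j)))

    Z-zero : ∀ i j → X i j ≈ δ i j * X i i → Z i j ≈ 0#
    Z-zero i j eq = trans (*-congˡ (trans (+-congʳ eq) (solve 1 (λ x → x :- x := con (+ 0)) refl (δ i j * X i i)))) (zeroʳ (r i * r j))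

    diagonal-part : Vector Carrier n → Carrier
    diagonal-part w = ∑[ i < n ] (r i * r i * X i i * (w i * w i))

    scaled : Vector Carrier n → Vector Carrier n
    scaled w i = r i * w i

    Z*ⱽ : ∀ w i → (Z *ⱽ w) i ≈ r i * (X *ⱽ scaled w) i - r i * r i * X i i * w i
    Z*ⱽ w i = begin
      ∑[ j < n ] (r i * r j * (X i j - δ i j * X i i) * w j)
        ≈⟨ sum-cong-≋ (λ j → solve 6 (λ r q x e d w → r :* q :* (x :- e :* d) :* w := r :* (x :* (q :* w)) :- e :* (r :* q :* d :* w))
             refl (r i) (r j) (X i j) (δ i j) (X i i) (w j)) ⟩
      ∑[ j < n ] (r i * (X i j * (r j * w j)) - δ i j * (r i * r j * X i i * w j))
        ≈⟨ ∑-distrib-- (λ j → r i * (X i j * (r j * w j))) (λ j → δ i j * (r i * r j * X i i * w j)) ⟩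
      ∑[ j < n ] (r i * (X i j * (r j * w j))) - ∑[ j < n ] (δ i j * (r i * r j * X i i * w j))
        ≈⟨ +-cong (sym (*-distribˡ-sum (r i) (λ j → X i j * (r j * w j)))) (-‿cong (∑-δˡ i (λ j → r i * r j * X i i * w j))) ⟩
      r i * (X *ⱽ scaled w) i - r i * r i * X i i * w i ∎

    Z-quadratic : ∀ w → w ∙ (Z *ⱽ w) ≈ scaled w ∙ (X *ⱽ scaled w) - diagonal-part w
    Z-quadratic w = begin
      ∑[ i < n ] (w i * (Z *ⱽ w) i)
        ≈⟨ sum-cong-≋ (λ i → trans (*-congˡ (Z*ⱽ w i)) (solve 4 (λ w r y d → w :* (r :* y :- r :* r :* d :* w) := r :* w :* y :- r :* r :* d :* (w :* w))
             refl (w i) (r i) ((X *ⱽ scaled w) i) (X i i))) ⟩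
      ∑[ i < n ] (scaled w i * (X *ⱽ scaled w) i - r i * r i * X i i * (w i * w i))
        ≈⟨ ∑-distrib-- (λ i → scaled w i * (X *ⱽ scaled w) i) (λ i → r i * r i * X i i * (w i * w i)) ⟩
      scaled w ∙ (X *ⱽ scaled w) - diagonal-part w ∎

    -- The form of `Z` is the form of `X` at the scaled vector, which is nonnegative, minus a
    -- diagonal part of at most w∙w.
    Z-lowerBound : LowerBound Z (- 1#)
    Z-lowerBound w = ≤+nonneg (+-nonneg (X-psd (scaled w)) (≤⇒0≤- diagonal-part≤)) (trans (Z-quadratic w)
        (solve 3 (λ x d n → x :- d := :- con (+ 1) :* n :+ (x :+ (n :- d))) refl (scaled w ∙ (X *ⱽ scaled w)) (diagonal-part w) (w ∙ w)))
      where
      diagonal-part≤ : diagonal-part w ≤ w ∙ w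
      diagonal-part≤ = ∑-mono-≤ (λ i → ≤-trans (*-monoʳ (sq-nonneg (w i)) (r²X≤1 i)) (≤-reflexive (*-identityˡ (w i * w i))))

    s-unit : s ∙ s ≈ 1#
    s-unit = trans (sum-cong-≋ s²) X-tr

    diagonal-part-s : diagonal-part s ≈ 1#
    diagonal-part-s = trans (sum-cong-≋ (λ i → begin
      r i * r i * X i i * (s i * s i)    ≈⟨ solve 3 (λ r s x → r :* r :* x :* (s :* s) := r :* s :* (r :* s :* x)) refl (r i) (s i) (X i i) ⟩
      ρ i * (ρ i * X i i)                ≈⟨ trans (*-congˡ (ρ*X i i)) (ρ*X i i) ⟩
      X i i                              ∎)) X-tr

    -- Scaling `s` gives `ρ`, which acts on `X` from either side like the all-ones vector.
    scaled-s : scaled s ∙ (X *ⱽ scaled s) ≈ ⟨ J , X ⟩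
    scaled-s = begin
      ∑[ i < n ] (ρ i * ∑[ j < n ] (X i j * ρ j))        ≈⟨ sum-cong-≋ (λ i → *-distribˡ-sum (ρ i) (λ j → X i j * ρ j)) ⟩
      ∑[ i < n ] ∑[ j < n ] (ρ i * (X i j * ρ j))        ≈⟨ sum-cong-≋ (λ i → sum-cong-≋ (λ j → entry i j)) ⟩
      ∑[ i < n ] ∑[ j < n ] (1# * X j i)                 ∎
      where
      entry : ∀ i j → ρ i * (X i j * ρ j) ≈ 1# * X j i
      entry i j = begin
        ρ i * (X i j * ρ j)     ≈⟨ solve 3 (λ p x q → p :* (x :* q) := q :* (p :* x)) refl (ρ i) (X i j) (ρ j) ⟩
        ρ j * (ρ i * X i j)     ≈⟨ *-congˡ (trans (ρ*X i j) (X-sym i j)) ⟩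
        ρ j * X j i             ≈⟨ ρ*X j i ⟩
        X j i                   ≈⟨ *-identityˡ (X j i) ⟨
        1# * X j i              ∎

    Z-quadratic-s : s ∙ (Z *ⱽ s) ≈ ⟨ J , X ⟩ - 1#
    Z-quadratic-s = trans (Z-quadratic s) (+-cong scaled-s (-‿cong diagonal-part-s))

  psd-diagonal : ∀ {n} {X : Matrix n} → PositiveSemidefinite X → ∀ i → 0# ≤ X i i
  psd-diagonal {X = X} psd i = ≤-resp refl (δ-quadratic X i) (psd (δ i))

  -- For the normalised matrix Z of X we have λ₁ ≥ ⟨J,X⟩ − 1, while every eigenvalue is at least −1.
  theta-bound : ∀ {n h} (G : Graph (suc n)) (X : Matrix (suc n)) →
                ThetaFeasible (complement G) X → SpectralBound G h → ⟨ J , X ⟩ ≤ h · 1#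
  theta-bound {h = zero}  G X _ ()
  theta-bound {n} {suc k} G X (X-sym , X-tr , X-supp , X-psd) (k≤N , bound) = for-family (eigenbasis Z Z-sym)
    where
    open Normalised {X = X} X-sym X-psd X-tr (λ i → inverseRoot (psd-diagonal {X = X} X-psd i))
    Z-supp : ∀ i j → ¬ Adj G i j → Z i j ≈ 0#
    -- A non-edge of `G` is either a diagonal position or an edge of the complement, where
    -- feasibility makes `X` vanish.
    Z-supp i j ¬ij = Z-zero i j (case i Fin.≟ j of λ where
      (yes ≡.refl) → sym (trans (*-congʳ (δ-refl i)) (*-identityˡ (X i i)))
      (no  i≢j)    → trans (X-supp i j (i≢j , ¬ij)) (sym (trans (*-congʳ (δ-≢ i≢j)) (zeroˡ (X i i)))))
    for-family : EigenFamily Z (suc n) → ⟨ J , X ⟩ ≤ 1# + k · 1#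
    -- The gap 1 + k - ⟨J,X⟩ is the sum of three nonnegative slacks: λ₁ - (⟨J,X⟩ - 1), -(λ₁ + small)
    -- and small + k.
    for-family F = ≤+nonneg (+-nonneg (≤⇒0≤- λ₁-large) (+-nonneg (≤⇒0≤- (bound Z Z-sym Z-supp value spectrum)) (≤⇒0≤- small-eigenvalues)))
        (solve 4 (λ j l s k → con (+ 1) :+ k := j :+ ((l :- (j :- con (+ 1))) :+ ((con (+ 0) :- (l :+ s)) :+ (s :- :- k))))
          refl ⟨ J , X ⟩ (value zero) small (k · 1#))
      where
      open EigenFamily F
      spectrum : IsSpectrum Z value
      spectrum = Spectral.isSpectrum {A = Z} Z-sym F
      small = ∑[ i < k ] value (opposite (inject≤ i k≤N))
      λ₁-large : ⟨ J , X ⟩ - 1# ≤ value zero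
      λ₁-large = ≤-resp Z-quadratic-s (trans (*-congˡ s-unit) (*-identityʳ (value zero))) (rayleigh-≤-first {A = Z} Z-sym F s)
      small-eigenvalues : - (k · 1#) ≤ small
      small-eigenvalues = ≤-trans (≤-reflexive (begin
          - (k · 1#)              ≈⟨ solve 1 (λ x → :- x := :- con (+ 1) :* x) refl (k · 1#) ⟩
          - 1# * (k · 1#)         ≈⟨ *-congˡ (sum-replicate k) ⟨
          - 1# * ∑[ i < k ] 1#    ≈⟨ *-distribˡ-sum {k} (- 1#) (λ _ → 1#) ⟩
          ∑[ i < k ] (- 1# * 1#)  ≈⟨ sum-cong-≋ {k} (λ _ → *-identityʳ (- 1#)) ⟩
          ∑[ i < k ] (- 1#)       ∎))
        (∑-mono-≤ (λ i → lowerBound-≤-value {A = Z} Z-lowerBound F (opposite (inject≤ i k≤N))))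
        where open ≈-R

open import Data.Integer.Base using (ℤ; +_) renaming (_≤_ to _≤ℤ_)
open import Data.Nat.Base using (ℕ; suc; _≤_)

theorem2 : ExcludedMiddle 0ℓ → (ℝ : Reals) → let open OverReals ℝ in
    ∀ {n : ℕ} (G : Graph (suc n)) (ϑ : Reals.Carrier ℝ) (c : ℤ) (h χ : ℕ) →
    IsLovászTheta (complement G) ϑ → IsCeiling ϑ c →
    IsH G h → IsChromaticNumber G χ →
    c ≤ℤ + h × h ≤ χ
theorem2 _ ℝ {n} G ϑ c h χ ((X , feasible , ⟨J,X⟩≈ϑ) , _) (_ , ceiling) (h-bound , h-least) χ-chromatic =
    -- The value ϑ is attained at the feasible `X`, so bounding ⟨J,X⟩ bounds ϑ by the integer h, and
    -- the ceiling is the least integer with that property.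
    ceiling (+ h) (≤-resp ⟨J,X⟩≈ϑ refl (theta-bound G X feasible h-bound))
  , h-least χ (chromatic-bound G χ-chromatic)
  where
  open Theory ℝ using (≤-resp; theta-bound; chromatic-bound)
  open CommutativeRing (Reals.commutativeRing ℝ) using (refl)
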